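{- Let $\mathcal{A}$ be a finite list of elements of a finitely generated abelian group $\Gamma$, let $G$ be a torsion-wise finite abelian group, and suppose $\mathcal{A}\subset\Gamma_{\mathrm{tor}}$. Then $$T^G_{\mathcal{A}}(x,y)=\sum_{k=0}^{\#\mathcal{A}}\Bigg(\sum_{\substack{\mathcal{S}\subset\mathcal{A}\\ \#\mathcal{S}=k}}\#\mathcal{M}(\mathcal{A}/\mathcal{S};\Gamma_{\mathrm{tor}}/\langle\mathcal{S}\rangle,G)\Bigg)y^k.$$ In particular $T^G_{\mathcal{A}}(x,y)$ is a polynomial in $y$ alone whose coefficients are non-negative integers.
   Context: $G$ is torsion-wise finite if $G[d]=\{x\in G\mid dx=0\}$ is finite for all $d>0$. Sublists are distinguished by index. $r_{\mathcal{S}}$ is the rank of $\langle\mathcal{S}\rangle$, $m(\mathcal{S};G)=\#\mathrm{Hom}((\Gamma/\langle\mathcal{S}\rangle)_{\mathrm{tor}},G)$, $T^G_{\mathcal{A}}(x,y)=\sum_{\mathcal{S}\subset\mathcal{A}}m(\mathcal{S};G)(x-1)^{r_{\mathcal{A}}-r_{\mathcal{S}}}(y-1)^{\#\mathcal{S}-r_{\mathcal{S}}}$. For a list $\mathcal{B}$ in an abelian group $\Lambda$, $\mathcal{M}(\mathcal{B};\Lambda,G)=\mathrm{Hom}(\Lambda,G)\smallsetminus\bigcup_{\beta\in\mathcal{B}}\{\varphi\mid\varphi(\beta)=0\}$; the contraction $\mathcal{A}/\mathcal{S}$ is the list of cosets $\{\overline\alpha\mid\alpha\in\mathcal{A}\smallsetminus\mathcal{S}\}$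 in $\Gamma_{\mathrm{tor}}/\langle\mathcal{S}\rangle$. -}

module Defs where

open import Algebra.Bundles using (AbelianGroup; RawRing)
import Algebra.Definitions.RawMonoid as RawMonoidDefs
import Algebra.Definitions.RawSemiring as RawSemiringDefs
open import Algebra.Morphism.Bundles using (GroupHomomorphism)
import Algebra.Properties.AbelianGroup as AbelianGroupProperties
import Algebra.Properties.CommutativeMonoid.Mult as Mult
import Algebra.Properties.Group as GroupProperties
open import Axiom.ExcludedMiddle using (ExcludedMiddle)
open import Data.Fin.Base using (Fin)
open import Data.Fin.Subset using (Subset; _∈_; _∉_; ∣_∣; ⊤; inside; outside)
open import Data.Integer.Base as ℤ using (ℤ; +_; -[1+_])
open import Data.List.Base as List using (List; []; _∷_; _++_)
open import Data.Nat.Base as ℕ using (ℕ; zero; suc; _∸_; NonZero)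
open import Data.Nat.Properties using (_≟_; m*n≢0) renaming (*-comm to ℕ-*-comm)
open import Data.Product.Base using (Σ; ∃; _×_; _,_; proj₁)
open import Data.Vec.Base as Vec using ()
open import Data.Vec.Functional using (Vector)
open import Function.Base using (_on_)
open import Function.Bundles using (Inverse)
open import Level using (Level; _⊔_; 0ℓ)
open import Relation.Binary.Bundles using (Setoid)
import Relation.Binary.Construct.On as On
open import Relation.Binary.PropositionalEquality using (_≡_; setoid)
import Relation.Binary.Reasoning.Setoid as SetoidReasoning
open import Relation.Nullary using (¬_; yes; no)
open import Relation.Unary using (Pred)

private
  variable
    a c ℓ c′ ℓ′ p : Level

-- Abelian groups are written additively in the comments and, following the
-- library's `AbelianGroup`, multiplicatively in the code.

------------------------------------------------------------------------

module _ (Γ : AbelianGroup c ℓ) where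
  open AbelianGroup Γ
  open RawMonoidDefs rawMonoid using () renaming (_×_ to _·ℕ_; sum to ∑)

  infixr 8 _·_
  _·_ : ℤ → Carrier → Carrier
  (+ n)    · x = n ·ℕ x
  -[1+ n ] · x = (suc n ·ℕ x) ⁻¹

  IsTorsion : Carrier → Set ℓ
  IsTorsion x = Σ ℕ λ d → NonZero d × d ·ℕ x ≈ ε

  LinearlyIndependent : ∀ {k} → Vector Carrier k → Set ℓ
  LinearlyIndependent {k} v =
    (z : Vector ℤ k) → ∑ (λ i → z i · v i) ≈ ε → ∀ i → z i ≡ + 0

  IsRank : ℕ → Set (c ⊔ ℓ)
  IsRank r =
    (Σ (Vector Carrier r) LinearlyIndependent)
    × (∀ {k} (v : Vector Carrier k) → LinearlyIndependent v → k ℕ.≤ r)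

  record Subgroup p : Set (c ⊔ ℓ ⊔ Level.suc p) where
    field
      contains  : Pred Carrier p
      resp      : ∀ {x y} → x ≈ y → contains x → contains y
      ε-closed  : contains ε
      ∙-closed  : ∀ {x y} → contains x → contains y → contains (x ∙ y)
      ⁻¹-closed : ∀ {x} → contains x → contains (x ⁻¹)

  -- Membership in the least subgroup containing all v i.
  data Generated {I : Set} (v : I → Carrier) : Pred Carrier (c ⊔ ℓ) where
    gen  : ∀ i → Generated v (v i)
    resp : ∀ {x y} → x ≈ y → Generated v x → Generated v y
    unit : Generated v ε
    mult : ∀ {x y} → Generated v x → Generated v y → Generated v (x ∙ y)
    inv  : ∀ {x} → Generated v x → Generated v (x ⁻¹)

  span : {I : Set} → (I → Carrier) → Subgroup (c ⊔ ℓ)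
  span v = record
    { contains = Generated v ; resp = resp ; ε-closed = unit
    ; ∙-closed = mult ; ⁻¹-closed = inv }

  FinitelyGenerated : Set (c ⊔ ℓ)
  FinitelyGenerated =
    Σ ℕ λ k → Σ (Vector Carrier k) λ g → ∀ x → Generated g x

  torsion : Subgroup ℓ
  torsion = record
    { contains  = IsTorsion
    ; resp      = λ x≈y (d , d≢0 , dx≈ε) →
        d , d≢0 , trans (×-congʳ d (sym x≈y)) dx≈ε
    ; ε-closed  = 1 , _ , identityʳ ε
    ; ∙-closed  = λ (d , d≢0 , dx≈ε) (e , e≢0 , ey≈ε) →
        d ℕ.* e , m*n≢0 d e {{d≢0}} {{e≢0}} ,
        trans (×-distrib-+ _ _ (d ℕ.* e))
          (trans (∙-cong
              (trans (×-congˡ (ℕ-*-comm d e)) (multiple e d dx≈ε))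
              (multiple d e ey≈ε))
            (identityʳ ε))
    ; ⁻¹-closed = λ (d , d≢0 , dx≈ε) →
        d , d≢0 , trans (×-⁻¹ d _) (trans (⁻¹-cong dx≈ε) ε⁻¹≈ε)
    }
    where
    open Mult commutativeMonoid
      using (×-congʳ; ×-congˡ; ×-assocˡ; ×-distrib-+)
    open GroupProperties group using (ε⁻¹≈ε)
    open AbelianGroupProperties Γ using (⁻¹-∙-comm)

    ×-ε : ∀ n → n ·ℕ ε ≈ ε
    ×-ε zero    = refl
    ×-ε (suc n) = trans (identityˡ _) (×-ε n)

    ×-⁻¹ : ∀ n x → n ·ℕ (x ⁻¹) ≈ (n ·ℕ x) ⁻¹
    ×-⁻¹ zero    x = sym ε⁻¹≈ε
    ×-⁻¹ (suc n) x = trans (∙-congˡ (×-⁻¹ n x)) (⁻¹-∙-comm _ _)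

    multiple : ∀ m n {x} → n ·ℕ x ≈ ε → (m ℕ.* n) ·ℕ x ≈ ε
    multiple m n nx≈ε =
      trans (sym (×-assocˡ _ m n)) (trans (×-congʳ m nx≈ε) (×-ε m))

  toGroup : Subgroup p → AbelianGroup (c ⊔ p) ℓ
  toGroup H = record
    { Carrier = Σ Carrier contains
    ; _≈_     = _≈_ on proj₁
    ; _∙_     = λ (x , hx) (y , hy) → x ∙ y , ∙-closed hx hy
    ; ε       = ε , ε-closed
    ; _⁻¹     = λ (x , hx) → x ⁻¹ , ⁻¹-closed hx
    ; isAbelianGroup = record
      { isGroup = record
        { isMonoid = record
          { isSemigroup = record
            { isMagma = record
              { isEquivalence = On.isEquivalence proj₁ isEquivalence
              ; ∙-cong        = ∙-cong
              }
            ; assoc = λ _ _ _ → assoc _ _ _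
            }
          ; identity = (λ _ → identityˡ _) , (λ _ → identityʳ _)
          }
        ; inverse = (λ _ → inverseˡ _) , (λ _ → inverseʳ _)
        ; ⁻¹-cong = ⁻¹-cong
        }
      ; comm = λ _ _ → comm _ _
      }
    }
    where open Subgroup H

  -- The carrier is that of Γ; two elements are identified when their difference
  -- lies in H, so every element of Γ also serves as a name for its coset.
  infixl 7 _/_
  _/_ : Subgroup p → AbelianGroup c p
  _/_ H = record
    { Carrier = Carrier
    ; _≈_     = _~_
    ; _∙_     = _∙_
    ; ε       = ε
    ; _⁻¹     = _⁻¹
    ; isAbelianGroup = record
      { isGroup = record
        { isMonoid = record
          { isSemigroup = record
            { isMagma = record
              { isEquivalence = record
                { refl  = ≈⇒~ refl
                ; sym   = ~-sym
                ; trans = ~-trans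
                }
              ; ∙-cong = ~-∙-cong
              }
            ; assoc = λ x y z → ≈⇒~ (assoc x y z)
            }
          ; identity = (λ x → ≈⇒~ (identityˡ x)) , (λ x → ≈⇒~ (identityʳ x))
          }
        ; inverse = (λ x → ≈⇒~ (inverseˡ x)) , (λ x → ≈⇒~ (inverseʳ x))
        ; ⁻¹-cong = ~-⁻¹-cong
        }
      ; comm = λ x y → ≈⇒~ (comm x y)
      }
    }
    where
    open Subgroup H renaming (resp to H-resp)
    open GroupProperties group using (⁻¹-involutive)
    open AbelianGroupProperties Γ using (⁻¹-∙-comm)
    open SetoidReasoning (AbelianGroup.setoid Γ)

    _~_ : Carrier → Carrier → Set _
    x ~ y = contains (x ∙ y ⁻¹)

    ≈⇒~ : ∀ {x y} → x ≈ y → x ~ y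
    ≈⇒~ {x} {y} x≈y =
      H-resp (sym (trans (∙-congʳ x≈y) (inverseʳ y))) ε-closed

    ~-sym : ∀ {x y} → x ~ y → y ~ x
    ~-sym {x} {y} h = H-resp (begin
      (x ∙ y ⁻¹) ⁻¹     ≈⟨ ⁻¹-∙-comm x (y ⁻¹) ⟨
      x ⁻¹ ∙ (y ⁻¹) ⁻¹  ≈⟨ ∙-congˡ (⁻¹-involutive y) ⟩
      x ⁻¹ ∙ y          ≈⟨ comm _ _ ⟩
      y ∙ x ⁻¹          ∎) (⁻¹-closed h)

    ~-trans : ∀ {x y z} → x ~ y → y ~ z → x ~ z
    ~-trans {x} {y} {z} h k = H-resp (begin
      (x ∙ y ⁻¹) ∙ (y ∙ z ⁻¹)  ≈⟨ assoc _ _ _ ⟩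
      x ∙ (y ⁻¹ ∙ (y ∙ z ⁻¹))  ≈⟨ ∙-congˡ (assoc _ _ _) ⟨
      x ∙ ((y ⁻¹ ∙ y) ∙ z ⁻¹)  ≈⟨ ∙-congˡ (∙-congʳ (inverseˡ y)) ⟩
      x ∙ (ε ∙ z ⁻¹)           ≈⟨ ∙-congˡ (identityˡ _) ⟩
      x ∙ z ⁻¹                 ∎) (∙-closed h k)

    ~-∙-cong : ∀ {x y u v} → x ~ y → u ~ v → (x ∙ u) ~ (y ∙ v)
    ~-∙-cong {x} {y} {u} {v} h k = H-resp (begin
      (x ∙ y ⁻¹) ∙ (u ∙ v ⁻¹)  ≈⟨ assoc _ _ _ ⟩
      x ∙ (y ⁻¹ ∙ (u ∙ v ⁻¹))  ≈⟨ ∙-congˡ (assoc _ _ _) ⟨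
      x ∙ ((y ⁻¹ ∙ u) ∙ v ⁻¹)  ≈⟨ ∙-congˡ (∙-congʳ (comm _ _)) ⟩
      x ∙ ((u ∙ y ⁻¹) ∙ v ⁻¹)  ≈⟨ ∙-congˡ (assoc _ _ _) ⟩
      x ∙ (u ∙ (y ⁻¹ ∙ v ⁻¹))  ≈⟨ assoc _ _ _ ⟨
      (x ∙ u) ∙ (y ⁻¹ ∙ v ⁻¹)  ≈⟨ ∙-congˡ (⁻¹-∙-comm y v) ⟩
      (x ∙ u) ∙ (y ∙ v) ⁻¹     ∎) (∙-closed h k)

    ~-⁻¹-cong : ∀ {x y} → x ~ y → (x ⁻¹) ~ (y ⁻¹)
    ~-⁻¹-cong {x} {y} h = H-resp (sym (⁻¹-∙-comm x (y ⁻¹))) (⁻¹-closed h)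

_tor : AbelianGroup c ℓ → AbelianGroup (c ⊔ ℓ) ℓ
Γ tor = toGroup Γ (torsion Γ)

------------------------------------------------------------------------

HasCardinality : Setoid a ℓ → ℕ → Set (a ⊔ ℓ)
HasCardinality X n = Inverse X (setoid (Fin n))

-- G[d], the d-torsion of G.
kernel : (G : AbelianGroup c ℓ) → ℕ → Setoid (c ⊔ ℓ) ℓ
kernel G d = On.setoid {B = Σ Carrier λ x → d ·ℕ x ≈ ε} G.setoid proj₁
  where
  module G = AbelianGroup G
  open G using (Carrier; _≈_; ε)
  open RawMonoidDefs G.rawMonoid using () renaming (_×_ to _·ℕ_)

TorsionWiseFinite : AbelianGroup c ℓ → Set (c ⊔ ℓ)
TorsionWiseFinite G = ∀ d → NonZero d → ∃ (HasCardinality (kernel G d))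

Hom : AbelianGroup c ℓ → AbelianGroup c′ ℓ′ →
      Setoid (c ⊔ ℓ ⊔ c′ ⊔ ℓ′) (c ⊔ ℓ′)
Hom Λ G = record
  { Carrier = GroupHomomorphism Λ.rawGroup G.rawGroup
  ; _≈_     = λ φ ψ → ∀ x → ⟦ φ ⟧ x G.≈ ⟦ ψ ⟧ x
  ; isEquivalence = record
    { refl  = λ _ → G.refl
    ; sym   = λ e x → G.sym (e x)
    ; trans = λ e f x → G.trans (e x) (f x)
    }
  }
  where
  module Λ = AbelianGroup Λ
  module G = AbelianGroup G
  open GroupHomomorphism using (⟦_⟧)

-- 𝓜(𝓑; Λ, G); the list 𝓑 may be indexed by any set.
𝓜 : {I : Set} (Λ : AbelianGroup c ℓ) → (I → AbelianGroup.Carrier Λ) →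
    (G : AbelianGroup c′ ℓ′) → Setoid (c ⊔ ℓ ⊔ c′ ⊔ ℓ′) (c ⊔ ℓ′)
𝓜 Λ 𝓑 G =
  On.setoid {B = Σ (Setoid.Carrier (Hom Λ G)) λ φ → ∀ i → ¬ ⟦ φ ⟧ (𝓑 i) G.≈ G.ε}
            (Hom Λ G) proj₁
  where
  module G = AbelianGroup G
  open GroupHomomorphism using (⟦_⟧)

------------------------------------------------------------------------
-- Sublists of a list of length n: subsets of its set of indices

restrict : ∀ {n} {A : Set a} → Vector A n → (S : Subset n) → (∃ λ i → i ∈ S) → A
restrict 𝓐 S (i , _) = 𝓐 i

remove : ∀ {n} {A : Set a} → Vector A n → (S : Subset n) → (∃ λ i → i ∉ S) → A
remove 𝓐 S (i , _) = 𝓐 i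

subsets : ∀ n → List (Subset n)
subsets zero    = Vec.[] ∷ []
subsets (suc n) =
  List.map (outside Vec.∷_) (subsets n) ++ List.map (inside Vec.∷_) (subsets n)

subsetsOfSize : ∀ n → ℕ → List (Subset n)
subsetsOfSize n k = List.filter (λ S → ∣ S ∣ ≟ k) (subsets n)

------------------------------------------------------------------------

module _ (R : RawRing c ℓ) where
  open RawRing R

  -- a₀ ∷ a₁ ∷ … stands for a₀ + a₁ X + …; trailing zeros are allowed.
  coefficient : List Carrier → ℕ → Carrier
  coefficient []      i       = 0#
  coefficient (a ∷ p) zero    = a
  coefficient (a ∷ p) (suc i) = coefficient p i

  addPoly : List Carrier → List Carrier → List Carrier
  addPoly []      q       = q
  addPoly (a ∷ p) []      = a ∷ p
  addPoly (a ∷ p) (b ∷ q) = a + b ∷ addPoly p q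

  mulPoly : List Carrier → List Carrier → List Carrier
  mulPoly []      q = []
  mulPoly (a ∷ p) q = addPoly (List.map (a *_) q) (0# ∷ mulPoly p q)

  polynomialRing : RawRing c ℓ
  polynomialRing = record
    { Carrier = List Carrier
    ; _≈_     = λ p q → ∀ i → coefficient p i ≈ coefficient q i
    ; _+_     = addPoly
    ; _*_     = mulPoly
    ; -_      = List.map -_
    ; 0#      = []
    ; 1#      = 1# ∷ []
    }

ℤ[y] : RawRing 0ℓ 0ℓ
ℤ[y] = polynomialRing ℤ.+-*-rawRing

-- ℤ[x,y] is (ℤ[y])[x].
ℤ[x,y] : RawRing 0ℓ 0ℓ
ℤ[x,y] = polynomialRing ℤ[y]

Polynomial : Set
Polynomial = RawRing.Carrier ℤ[x,y]

open RawRing ℤ[x,y] public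
  using (_≈_; _+_; _*_; -_; 0#; 1#)
open RawSemiringDefs (RawRing.rawSemiring ℤ[x,y]) public
  using (_^_) renaming (_×_ to _·ₚ_)

𝕩 𝕪 : Polynomial
𝕩 = RawRing.0# ℤ[y] ∷ RawRing.1# ℤ[y] ∷ []
𝕪 = (+ 0 ∷ + 1 ∷ []) ∷ []

coeff-x^_y^_ : ℕ → ℕ → Polynomial → ℤ
(coeff-x^ i y^ j) P = coefficient ℤ.+-*-rawRing (coefficient ℤ[y] P i) j

∑ : {A : Set a} → List A → (A → Polynomial) → Polynomial
∑ xs f = List.foldr _+_ 0# (List.map f xs)

------------------------------------------------------------------------

-- Cardinalities and ranks as total functions: excluded middle is what makes
-- them definable.
module Classical (em : ∀ a → ExcludedMiddle a) where

  -- The number satisfying P, or 0 if there is none. It is applied only to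
  -- `HasCardinality X` and `IsRank H`, which hold of at most one number. For
  -- Γ finitely generated and G torsion-wise finite, every set counted and
  -- every rank taken below is finite, so the value 0 is never a default.
  the : (ℕ → Set a) → ℕ
  the P with em _ {∃ P}
  ... | yes (n , _) = n
  ... | no _        = 0

  #_ : Setoid a ℓ → ℕ
  # X = the (HasCardinality X)

  rank : AbelianGroup c ℓ → ℕ
  rank H = the (IsRank H)

  module _ (Γ : AbelianGroup c ℓ) {n : ℕ}
           (𝓐 : Vector (AbelianGroup.Carrier Γ) n) where

    r : Subset n → ℕ
    r S = rank (toGroup Γ (span Γ (restrict 𝓐 S)))

    m : Subset n → AbelianGroup c′ ℓ′ → ℕ
    m S G = # Hom ((Γ / span Γ (restrict 𝓐 S)) tor) G

    -- The truncated subtractions are exact: r S ≤ r ⊤ and r S ≤ ∣ S ∣.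
    tutte : AbelianGroup c′ ℓ′ → Polynomial
    tutte G = ∑ (subsets n) λ S →
      m S G ·ₚ ((𝕩 + - 1#) ^ (r ⊤ ∸ r S) * (𝕪 + - 1#) ^ (∣ S ∣ ∸ r S))

    -- # 𝓜(𝓐/𝓢; Γ_tor/⟨𝓢⟩, G), for a list 𝓐 of torsion elements; here ⟨𝓢⟩
    -- is generated inside Γ_tor.
    #𝓜-contraction : (∀ i → IsTorsion Γ (𝓐 i)) → Subset n →
                     AbelianGroup c′ ℓ′ → ℕ
    #𝓜-contraction 𝓐-torsion S G =
      # 𝓜 ((Γ tor) / span (Γ tor) (restrict 𝓐ₜ S)) (remove 𝓐ₜ S) G
      where
      𝓐ₜ : Vector (AbelianGroup.Carrier (Γ tor)) n
      𝓐ₜ i = 𝓐 i , 𝓐-torsion i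

{-# OPTIONS --safe #-}
module Submission where

-- The elements of 𝓐 are torsion, so all ranks vanish and T is the sum over 𝓢
-- of m(𝓢) (y - 1)^#𝓢. Homomorphisms from Γ_tor/⟨𝓢⟩ ≅ (Γ/⟨𝓢⟩)_tor are the
-- φ : Γ_tor → G annihilating 𝓢; they lie in 𝓜(𝓐/𝓢) when the list Z(φ) of all
-- α ∈ 𝓐 with φ(α) = 0 is exactly 𝓢. Since Hom(Γ_tor, G) is finite, both sums
-- may be exchanged with a sum over φ: the left-hand side becomes the sum over φ
-- of Σ_{𝓢 ⊂ Z(φ)} (y - 1)^#𝓢 = y^#Z(φ), and so does the right-hand side.

open import Defs hiding (_≈_; _+_; _*_; -_; 0#; 1#; _^_)
open import Algebra.Bundles using (AbelianGroup; RawRing)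
open import Algebra.Morphism.Bundles using (GroupHomomorphism)
import Algebra.Properties.AbelianGroup as AbelianGroupProperties
import Algebra.Properties.CommutativeMonoid.Mult as Mult
import Algebra.Properties.CommutativeSemigroup as CommutativeSemigroupProperties
import Algebra.Properties.Group as GroupProperties
import Algebra.Properties.Monoid.Sum as MonoidSum
open import Axiom.ExcludedMiddle using (ExcludedMiddle)
open import Data.Bool.Base using (true; if_then_else_)
import Data.Bool.Properties as Bool
open import Data.Fin.Base using (Fin; zero; suc; combine; funToFin; finToFun)
open import Data.Fin.Permutation using (↔⇒≡)
open import Data.Fin.Properties using (finToFun-funToFin)
open import Data.Fin.Subset using (Subset; inside; outside; ∣_∣; ⊤; _⊆_)
  renaming (_∈_ to _∈ₛ_)
open import Data.Fin.Subset.Properties using (_⊆?_; _∈?_; ⊆-antisym; ∣p∣≤n)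
open import Data.Integer.Base as ℤ using (ℤ; +_)
import Data.Integer.Properties as ℤ
open import Data.List.Base
  using (List; []; _∷_; _++_; foldr; map; sum; upTo; filter; length; allFin; lookup)
open import Data.List.Membership.Propositional using (_∈_)
open import Data.List.Membership.Propositional.Properties
  using ( ∈-allFin; ∈-filter⁺; ∈-filter⁻; ∈-lookup; ∈-upTo⁺
        ; ∈-++⁺ˡ; ∈-++⁺ʳ; ∈-map⁺; ∈-map⁻)
open import Data.List.Properties using (map-cong; map-∘)
import Data.List.Relation.Unary.All as All
open import Data.List.Relation.Unary.AllPairs using ([]; _∷_)
open import Data.List.Relation.Unary.Any using (here; there; index)
open import Data.List.Relation.Unary.Any.Properties using (lookup-index)
open import Data.List.Relation.Unary.Unique.Propositional using (Unique)
import Data.List.Relation.Unary.Unique.Propositional.Properties as Unique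
open import Data.Nat.Base as ℕ using (ℕ; zero; suc; _∸_; NonZero)
open import Data.Nat.Induction using (<-rec)
import Data.Nat.Properties as ℕ
open import Data.Product.Base using (Σ; ∃; _×_; _,_; proj₁; proj₂)
open import Data.Sum.Base using (_⊎_; inj₁; inj₂)
open import Data.Vec.Base as Vec using ()
open import Data.Vec.Functional as V using (Vector)
open import Data.Vec.Properties
  using (∷-injectiveʳ; ≡-dec; lookup∘tabulate; lookup⇒[]=; []=⇒lookup)
open import Function.Base using (_∘_)
open import Function.Bundles using (Inverse; Injection)
import Function.Construct.Composition as Compose
import Function.Construct.Symmetry as Symmetry
open import Level using (Level; _⊔_)
open import Relation.Binary.Bundles using (Setoid)
open import Relation.Binary.Definitions using (DecidableEquality)
open import Relation.Binary.PropositionalEquality as ≡ using (_≡_; _≢_)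
import Relation.Binary.Reasoning.Setoid as SetoidReasoning
open import Relation.Nullary using (¬_; Dec; yes; no; does; contradiction)
open import Relation.Nullary.Decidable using (dec-true)
open import Relation.Unary using (Pred; Decidable)

-- The exchange of sums needs one enumeration of Hom(Γ_tor, G) that does not depend on 𝓢. It exists
-- because Γ_tor, as a subgroup of the finitely generated Γ, is itself finitely generated: a single
-- d > 0 kills its generators, and a homomorphism is determined by their images in the finite group
-- G[d]. The isomorphism Γ_tor/⟨𝓢⟩ ≅ (Γ/⟨𝓢⟩)_tor is not constructed. Both groups are presented, by
-- `IsQuotient`, as Γ_tor modulo the same list, and the homomorphisms on either are counted by
-- pulling them back to Γ_tor. Neither equality in G nor membership in a subgroup is decidable.
-- Excluded middle finds least multiples, decides which tuples of values come from a homomorphism,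
-- and tests φ(α) = 0. Polynomials are coefficient lists up to trailing zeros, so the identity is
-- proved one coefficient at a time, as an identity of integer sums.

private
  variable
    a b c ℓ c′ ℓ′ c″ ℓ″ p : Level

-- Finite setoids

lookup-injective : {A : Set a} {xs : List A} → Unique xs →
                   ∀ i j → lookup xs i ≡ lookup xs j → i ≡ j
lookup-injective (_  ∷ _) zero    zero    eq = ≡.refl
lookup-injective (x∉ ∷ _) zero    (suc j) eq =
  contradiction eq (All.lookup x∉ (∈-lookup j))
lookup-injective (x∉ ∷ _) (suc i) zero    eq =
  contradiction (≡.sym eq) (All.lookup x∉ (∈-lookup i))
lookup-injective (_  ∷ u) (suc i) (suc j) eq =
  ≡.cong suc (lookup-injective u i j eq)

hasCardinality-unique : {X : Setoid a ℓ} {m n : ℕ} →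
                        HasCardinality X m → HasCardinality X n → m ≡ n
hasCardinality-unique f g = ↔⇒≡ (Compose.inverse (Symmetry.inverse f) g)

-- `P` describes the image of `f` exactly, so an element can be numbered by the position of its
-- image among the indices satisfying `P`. The cardinality comes out as the length of a filtered
-- list, which turns into a sum of indicators.
image-cardinality :
  {X : Setoid a ℓ} {N : ℕ} (f : Injection X (≡.setoid (Fin N)))
  {P : Pred (Fin N) p} (P? : Decidable P) →
  (∀ x → P (Injection.to f x)) →
  (∀ {j} → P j → ∃ λ x → Injection.to f x ≡ j) →
  HasCardinality X (length (filter P? (allFin N)))
image-cardinality {X = X} {N} f {P} P? P-image preimage = record
  { to        = position
  ; from      = element
  ; to-cong   = λ {x} {y} x≈y → position-unique x (position y)
      (≡.trans (lookup-position y) (≡.sym (to-cong x≈y)))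
  ; from-cong = λ { ≡.refl → Setoid.refl X }
  ; inverse   =
      (λ {i} {x} x≈ → position-unique x i
        (≡.trans (≡.sym (to-element i)) (≡.sym (to-cong x≈))))
    , (λ {x} {i} i≡ → injective (≡.trans (to-element i)
        (≡.trans (≡.cong (lookup js) i≡) (lookup-position x))))
  }
  where
  open Injection f using (to; injective) renaming (cong to to-cong)
  js = filter P? (allFin N)

  position∈ : ∀ x → to x ∈ js
  position∈ x = ∈-filter⁺ P? (∈-allFin (to x)) (P-image x)

  position : Setoid.Carrier X → Fin (length js)
  position x = index (position∈ x)

  lookup-position : ∀ x → lookup js (position x) ≡ to x
  lookup-position x = ≡.sym (lookup-index (position∈ x))

  position-unique : ∀ x i → lookup js i ≡ to x → position x ≡ i
  position-unique x i eq = lookup-injective (Unique.filter⁺ P? (Unique.allFin⁺ N)) _ _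
    (≡.trans (lookup-position x) (≡.sym eq))

  preimage-lookup : ∀ i → ∃ λ x → to x ≡ lookup js i
  preimage-lookup i = preimage (proj₂ (∈-filter⁻ P? {xs = allFin N} (∈-lookup i)))

  element : Fin (length js) → Setoid.Carrier X
  element = proj₁ ∘ preimage-lookup

  to-element : ∀ i → to (element i) ≡ lookup js i
  to-element = proj₂ ∘ preimage-lookup

-- Subgroups and homomorphisms

-- Serves as the induction principle for spans: the property to be proved is packaged as a subgroup
-- `K`.
Generated-least : (Γ : AbelianGroup c ℓ) (K : Subgroup Γ p) →
  {I : Set} {v : I → AbelianGroup.Carrier Γ} → (∀ i → Subgroup.contains K (v i)) →
  ∀ {x} → Generated Γ v x → Subgroup.contains K x
Generated-least Γ K v∈K (gen i)     = v∈K i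
Generated-least Γ K v∈K (resp eq x) = Subgroup.resp K eq (Generated-least Γ K v∈K x)
Generated-least Γ K v∈K unit        = Subgroup.ε-closed K
Generated-least Γ K v∈K (mult x y)  =
  Subgroup.∙-closed K (Generated-least Γ K v∈K x) (Generated-least Γ K v∈K y)
Generated-least Γ K v∈K (inv x)     = Subgroup.⁻¹-closed K (Generated-least Γ K v∈K x)

-- Elements of `toGroup Γ K` carry a proof of membership, so the induction must produce one at every
-- stage; `K′` pairs it with the derivation. The outer `resp refl` replaces that proof by the given
-- `x∈K`, a change that equality in `toGroup Γ K` ignores.
Generated-toGroup : (Γ : AbelianGroup c ℓ) (K : Subgroup Γ p) →
  {I : Set} {v : I → AbelianGroup.Carrier Γ} (v∈K : ∀ i → Subgroup.contains K (v i)) →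
  ∀ {x} → Generated Γ v x → (x∈K : Subgroup.contains K x) →
  Generated (toGroup Γ K) (λ i → v i , v∈K i) (x , x∈K)
Generated-toGroup Γ K v∈K x∈⟨v⟩ x∈K =
  resp refl (proj₂ (Generated-least Γ K′ (λ i → v∈K i , gen i) x∈⟨v⟩))
  where
  open AbelianGroup Γ using (refl)
  open Subgroup K using (contains; ∙-closed; ⁻¹-closed; ε-closed) renaming (resp to K-resp)
  K′ : Subgroup Γ _
  K′ = record
    { contains  = λ x → Σ (contains x) λ x∈K →
        Generated (toGroup Γ K) (λ i → _ , v∈K i) (x , x∈K)
    ; resp      = λ x≈y (x∈K , gx) → K-resp x≈y x∈K , resp x≈y gx
    ; ε-closed  = ε-closed , unit
    ; ∙-closed  = λ (x∈K , gx) (y∈K , gy) → ∙-closed x∈K y∈K , mult gx gy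
    ; ⁻¹-closed = λ (x∈K , gx) → ⁻¹-closed x∈K , inv gx
    }

module _ (Γ : AbelianGroup c ℓ) (Λ : AbelianGroup c′ ℓ′) where
  private
    module Γ = AbelianGroup Γ
    module Λ = AbelianGroup Λ
  open Mult Γ.commutativeMonoid using () renaming (_×_ to _×Γ_)
  open Mult Λ.commutativeMonoid using () renaming (_×_ to _×Λ_)

  ×-homo : (f : GroupHomomorphism Γ.rawGroup Λ.rawGroup) → ∀ n x →
    GroupHomomorphism.⟦_⟧ f (n ×Γ x) Λ.≈ n ×Λ GroupHomomorphism.⟦_⟧ f x
  ×-homo f zero    x = GroupHomomorphism.ε-homo f
  ×-homo f (suc n) x = Λ.trans (GroupHomomorphism.homo f x _) (Λ.∙-congˡ (×-homo f n x))

  equalizer : (f g : GroupHomomorphism Γ.rawGroup Λ.rawGroup) → Subgroup Γ ℓ′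
  equalizer f g = record
    { contains  = λ x → f.⟦ x ⟧ Λ.≈ g.⟦ x ⟧
    ; resp      = λ x≈y fx≈gx → Λ.trans (f.⟦⟧-cong (Γ.sym x≈y)) (Λ.trans fx≈gx (g.⟦⟧-cong x≈y))
    ; ε-closed  = Λ.trans f.ε-homo (Λ.sym g.ε-homo)
    ; ∙-closed  = λ fx≈gx fy≈gy →
        Λ.trans (f.homo _ _) (Λ.trans (Λ.∙-cong fx≈gx fy≈gy) (Λ.sym (g.homo _ _)))
    ; ⁻¹-closed = λ fx≈gx →
        Λ.trans (f.⁻¹-homo _) (Λ.trans (Λ.⁻¹-cong fx≈gx) (Λ.sym (g.⁻¹-homo _)))
    }
    where
    module f = GroupHomomorphism f
    module g = GroupHomomorphism g

  kernelSubgroup : GroupHomomorphism Γ.rawGroup Λ.rawGroup → Subgroup Γ ℓ′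
  kernelSubgroup f = record
    { contains  = λ x → f.⟦ x ⟧ Λ.≈ Λ.ε
    ; resp      = λ x≈y fx≈ε → Λ.trans (f.⟦⟧-cong (Γ.sym x≈y)) fx≈ε
    ; ε-closed  = f.ε-homo
    ; ∙-closed  = λ fx≈ε fy≈ε →
        Λ.trans (f.homo _ _) (Λ.trans (Λ.∙-cong fx≈ε fy≈ε) (Λ.identityˡ _))
    ; ⁻¹-closed = λ fx≈ε →
        Λ.trans (f.⁻¹-homo _) (Λ.trans (Λ.⁻¹-cong fx≈ε) (GroupProperties.ε⁻¹≈ε Λ.group))
    }
    where module f = GroupHomomorphism f

  mkHom : (f : Γ.Carrier → Λ.Carrier) → (∀ {x y} → x Γ.≈ y → f x Λ.≈ f y) →
          (∀ x y → f (x Γ.∙ y) Λ.≈ f x Λ.∙ f y) → GroupHomomorphism Γ.rawGroup Λ.rawGroup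
  mkHom f f-cong f-∙ = record
    { ⟦_⟧ = f
    ; isGroupHomomorphism = record
      { isMonoidHomomorphism = record
        { isMagmaHomomorphism = record
          { isRelHomomorphism = record { cong = f-cong } ; homo = f-∙ }
        ; ε-homo = f-ε
        }
      ; ⁻¹-homo = λ x → inverseˡ-unique _ _
          (Λ.trans (Λ.sym (f-∙ _ _)) (Λ.trans (f-cong (Γ.inverseˡ x)) f-ε))
      }
    }
    where
    open GroupProperties Λ.group using (inverseˡ-unique; identityˡ-unique)
    f-ε : f Γ.ε Λ.≈ Λ.ε
    f-ε = identityˡ-unique _ _ (Λ.trans (Λ.sym (f-∙ Γ.ε Γ.ε)) (f-cong (Γ.identityˡ _)))

inclusion : (Γ : AbelianGroup c ℓ) (K : Subgroup Γ p) →
  GroupHomomorphism (AbelianGroup.rawGroup (toGroup Γ K)) (AbelianGroup.rawGroup Γ)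
inclusion Γ K = mkHom (toGroup Γ K) Γ proj₁ (λ eq → eq) (λ _ _ → AbelianGroup.refl Γ)

module _ (Γ : AbelianGroup c ℓ) (K : Subgroup Γ p) where
  open AbelianGroup Γ
  open Subgroup K using (contains) renaming (resp to K-resp)
  private module Γ/K = AbelianGroup (Γ / K)

  projection : GroupHomomorphism rawGroup Γ/K.rawGroup
  projection = mkHom Γ (Γ / K) (λ x → x)
    (λ {x} {y} x≈y → K-resp (sym (trans (∙-congʳ x≈y) (inverseʳ y))) (Subgroup.ε-closed K))
    (λ _ _ → Γ/K.refl)

  private
    x∙ε⁻¹≈x : ∀ x → x ∙ ε ⁻¹ ≈ x
    x∙ε⁻¹≈x x = trans (∙-congˡ (GroupProperties.ε⁻¹≈ε group)) (identityʳ x)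

  contains⇒≈ε : ∀ {x} → contains x → x Γ/K.≈ ε
  contains⇒≈ε {x} = K-resp (sym (x∙ε⁻¹≈x x))

  ≈ε⇒contains : ∀ {x} → x Γ/K.≈ ε → contains x
  ≈ε⇒contains {x} = K-resp (x∙ε⁻¹≈x x)

-- q presents Λ as the quotient of Δ by ⟨v⟩.
record IsQuotient (Δ : AbelianGroup c ℓ) (Λ : AbelianGroup c′ ℓ′) {I : Set}
                  (v : I → AbelianGroup.Carrier Δ)
                  (q : Setoid.Carrier (Hom Δ Λ)) : Set (c ⊔ ℓ ⊔ c′ ⊔ ℓ′) where
  private
    module Δ = AbelianGroup Δ
    module Λ = AbelianGroup Λ
  open GroupHomomorphism q using (⟦_⟧)
  field
    surjective : ∀ y → ∃ λ x → ⟦ x ⟧ Λ.≈ y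
    vanishes   : ∀ i → ⟦ v i ⟧ Λ.≈ Λ.ε
    generates  : ∀ {x} → ⟦ x ⟧ Λ.≈ Λ.ε → Generated Δ v x

-- Homomorphisms out of a quotient

module _ (Δ : AbelianGroup c ℓ) (Λ : AbelianGroup c′ ℓ′) (G : AbelianGroup c″ ℓ″)
         (q : Setoid.Carrier (Hom Δ Λ)) where
  private
    module Δ = AbelianGroup Δ
    module Λ = AbelianGroup Λ
    module G = AbelianGroup G
    module q = GroupHomomorphism q
  open GroupHomomorphism using (⟦_⟧)

  pullback : Setoid.Carrier (Hom Λ G) → Setoid.Carrier (Hom Δ G)
  pullback ψ = mkHom Δ G (λ x → ⟦ ψ ⟧ (q.⟦ x ⟧)) (λ x≈y → ψ.⟦⟧-cong (q.⟦⟧-cong x≈y))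
    (λ x y → G.trans (ψ.⟦⟧-cong (q.homo x y)) (ψ.homo _ _))
    where module ψ = GroupHomomorphism ψ

  module _ {I : Set} {v : I → Δ.Carrier} (isQuotient : IsQuotient Δ Λ v q) where
    open IsQuotient isQuotient

    pullback-vanishes : ∀ ψ i → ⟦ pullback ψ ⟧ (v i) G.≈ G.ε
    pullback-vanishes ψ i = G.trans (ψ.⟦⟧-cong (vanishes i)) ψ.ε-homo
      where module ψ = GroupHomomorphism ψ

    pullback-injective : ∀ ψ ψ′ → Setoid._≈_ (Hom Δ G) (pullback ψ) (pullback ψ′) →
                         Setoid._≈_ (Hom Λ G) ψ ψ′
    pullback-injective ψ ψ′ eq y = let x , qx≈y = surjective y in
      G.trans (ψ.⟦⟧-cong (Λ.sym qx≈y)) (G.trans (eq x) (ψ′.⟦⟧-cong qx≈y))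
      where
      module ψ  = GroupHomomorphism ψ
      module ψ′ = GroupHomomorphism ψ′

    -- `ψ` applies `φ` to chosen preimages under `q`. The choice `s` need not respect equality or
    -- products, but two preimages of one element differ by an element of ⟨v⟩, which `φ` kills;
    -- `respects` therefore yields everything required of `ψ`.
    factor : (φ : Setoid.Carrier (Hom Δ G)) → (∀ i → ⟦ φ ⟧ (v i) G.≈ G.ε) →
             ∃ λ ψ → Setoid._≈_ (Hom Δ G) (pullback ψ) φ
    factor φ φv≈ε = ψ , λ x → respects (qs≈ _)
      where
      module φ = GroupHomomorphism φ
      open SetoidReasoning Λ.setoid
      s : Λ.Carrier → Δ.Carrier
      s = proj₁ ∘ surjective
      qs≈ : ∀ y → q.⟦ s y ⟧ Λ.≈ y
      qs≈ = proj₂ ∘ surjective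

      respects : ∀ {x y} → q.⟦ x ⟧ Λ.≈ q.⟦ y ⟧ → φ.⟦ x ⟧ G.≈ φ.⟦ y ⟧
      respects {x} {y} qx≈qy = GroupProperties.x∙y⁻¹≈ε⇒x≈y G.group _ _
        (G.trans (G.sym (G.trans (φ.homo _ _) (G.∙-congˡ (φ.⁻¹-homo _))))
          (Generated-least Δ (kernelSubgroup Δ G φ) φv≈ε (generates (begin
            q.⟦ x Δ.∙ y Δ.⁻¹ ⟧        ≈⟨ q.homo _ _ ⟩
            q.⟦ x ⟧ Λ.∙ q.⟦ y Δ.⁻¹ ⟧  ≈⟨ Λ.∙-cong qx≈qy (q.⁻¹-homo y) ⟩
            q.⟦ y ⟧ Λ.∙ q.⟦ y ⟧ Λ.⁻¹  ≈⟨ Λ.inverseʳ _ ⟩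
            Λ.ε                       ∎))))

      ψ : Setoid.Carrier (Hom Λ G)
      ψ = mkHom Λ G (φ.⟦_⟧ ∘ s)
        (λ {y} {y′} y≈y′ → respects (Λ.trans (qs≈ y) (Λ.trans y≈y′ (Λ.sym (qs≈ y′)))))
        (λ y y′ → G.trans
          (respects (Λ.trans (qs≈ _) (Λ.sym (Λ.trans (q.homo _ _) (Λ.∙-cong (qs≈ y) (qs≈ y′))))))
          (φ.homo _ _))

module _ (Δ : AbelianGroup c ℓ) {I : Set} (v : I → AbelianGroup.Carrier Δ) where

  projection-isQuotient : IsQuotient Δ (Δ / span Δ v) v (projection Δ (span Δ v))
  projection-isQuotient = record
    { surjective = λ x → x , AbelianGroup.refl (Δ / span Δ v)
    ; vanishes   = λ i → contains⇒≈ε Δ (span Δ v) (gen i)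
    ; generates  = ≈ε⇒contains Δ (span Δ v)
    }

-- Torsion of a quotient by torsion elements

module _ (Γ : AbelianGroup c ℓ) {I : Set} (v : I → AbelianGroup.Carrier Γ)
         (v-torsion : ∀ i → IsTorsion Γ (v i)) where
  private
    module Γ = AbelianGroup Γ
    ⟨v⟩ = span Γ v
    module Γ/⟨v⟩ = AbelianGroup (Γ / ⟨v⟩)
    module × = Mult Γ.commutativeMonoid

  torsion-quotient : ∀ {x} → IsTorsion Γ x → IsTorsion (Γ / ⟨v⟩) x
  torsion-quotient {x} (d , d≢0 , dx≈ε) = d , d≢0 ,
    Γ/⟨v⟩.trans (Γ/⟨v⟩.sym (×-homo Γ (Γ / ⟨v⟩) (projection Γ ⟨v⟩) d x))
      (GroupHomomorphism.⟦⟧-cong (projection Γ ⟨v⟩) dx≈ε)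

  -- If dx lies in ⟨v⟩, some e > 0 kills dx, since the span of torsion elements is torsion; then ed
  -- kills x.
  torsion-lift : ∀ {x} → IsTorsion (Γ / ⟨v⟩) x → IsTorsion Γ x
  torsion-lift {x} (d , d≢0 , dx≈ε) =
    let e , e≢0 , edx≈ε = Generated-least Γ (torsion Γ) v-torsion
          (≈ε⇒contains Γ ⟨v⟩ (Γ/⟨v⟩.trans (×-homo Γ (Γ / ⟨v⟩) (projection Γ ⟨v⟩) d x) dx≈ε))
    in e ℕ.* d , ℕ.m*n≢0 e d {{e≢0}} {{d≢0}} ,
       Γ.trans (Γ.sym (×.×-assocˡ x e d)) edx≈ε

  torsion-projection : Setoid.Carrier (Hom (Γ tor) ((Γ / ⟨v⟩) tor))
  torsion-projection = mkHom (Γ tor) ((Γ / ⟨v⟩) tor)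
    (λ (x , t) → x , torsion-quotient t)
    (GroupHomomorphism.⟦⟧-cong (projection Γ ⟨v⟩))
    (λ _ _ → Γ/⟨v⟩.refl)

  -- The quotient has the carrier of Γ, so the projection keeps x and changes only its proof of
  -- torsion; `torsion-lift` makes it surjective.
  torsion-projection-isQuotient :
    IsQuotient (Γ tor) ((Γ / ⟨v⟩) tor) (λ i → v i , v-torsion i) torsion-projection
  torsion-projection-isQuotient = record
    { surjective = λ (x , t) → (x , torsion-lift t) , Γ/⟨v⟩.refl
    ; vanishes   = λ i → contains⇒≈ε Γ ⟨v⟩ (gen i)
    ; generates  = λ {(x , t)} x≈ε →
        Generated-toGroup Γ (torsion Γ) v-torsion (≈ε⇒contains Γ ⟨v⟩ x≈ε) t
    }

-- Finiteness of Hom (Γ tor) G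

module _ (Γ : AbelianGroup c ℓ) (g : AbelianGroup.Carrier Γ) where
  open AbelianGroup Γ
  open Mult commutativeMonoid using () renaming (_×_ to _·ℕ_; ×-homo-+ to ·ℕ-homo-+)
  open AbelianGroupProperties Γ using (⁻¹-∙-comm; xyx⁻¹≈y)
  open GroupProperties group using (⁻¹-involutive; ε⁻¹≈ε)
  open CommutativeSemigroupProperties commutativeSemigroup using (interchange)
  open SetoidReasoning setoid

  multiple-difference : ∀ m n → (m ℕ.+ n) ·ℕ g ∙ (m ·ℕ g) ⁻¹ ≈ n ·ℕ g
  multiple-difference m n = begin
    (m ℕ.+ n) ·ℕ g ∙ (m ·ℕ g) ⁻¹    ≈⟨ ∙-congʳ (·ℕ-homo-+ g m n) ⟩
    m ·ℕ g ∙ n ·ℕ g ∙ (m ·ℕ g) ⁻¹   ≈⟨ xyx⁻¹≈y (m ·ℕ g) (n ·ℕ g) ⟩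
    n ·ℕ g                          ∎

  -- The integer multiples of g, written as differences of natural ones so that closure under the
  -- operations needs no case distinction on signs.
  multiples : Subgroup Γ ℓ
  multiples = record
    { contains  = λ x → ∃ λ a → ∃ λ b → x ≈ a ·ℕ g ∙ (b ·ℕ g) ⁻¹
    ; resp      = λ x≈y (a , b , eq) → a , b , trans (sym x≈y) eq
    ; ε-closed  = 0 , 0 , sym (inverseʳ ε)
    ; ∙-closed  = λ {x} {y} (a , b , eq) (a′ , b′ , eq′) → a ℕ.+ a′ , b ℕ.+ b′ , (begin
        x ∙ y                                                  ≈⟨ ∙-cong eq eq′ ⟩
        (a ·ℕ g ∙ (b ·ℕ g) ⁻¹) ∙ (a′ ·ℕ g ∙ (b′ ·ℕ g) ⁻¹)      ≈⟨ interchange _ _ _ _ ⟩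
        (a ·ℕ g ∙ a′ ·ℕ g) ∙ ((b ·ℕ g) ⁻¹ ∙ (b′ ·ℕ g) ⁻¹)      ≈⟨ ∙-congˡ (⁻¹-∙-comm _ _) ⟩
        (a ·ℕ g ∙ a′ ·ℕ g) ∙ (b ·ℕ g ∙ b′ ·ℕ g) ⁻¹
          ≈⟨ ∙-cong (·ℕ-homo-+ g a a′) (⁻¹-cong (·ℕ-homo-+ g b b′)) ⟨
        (a ℕ.+ a′) ·ℕ g ∙ ((b ℕ.+ b′) ·ℕ g) ⁻¹                 ∎)
    ; ⁻¹-closed = λ {x} (a , b , eq) → b , a , (begin
        x ⁻¹                              ≈⟨ ⁻¹-cong eq ⟩
        (a ·ℕ g ∙ (b ·ℕ g) ⁻¹) ⁻¹         ≈⟨ ⁻¹-∙-comm _ _ ⟨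
        (a ·ℕ g) ⁻¹ ∙ ((b ·ℕ g) ⁻¹) ⁻¹    ≈⟨ ∙-congˡ (⁻¹-involutive _) ⟩
        (a ·ℕ g) ⁻¹ ∙ b ·ℕ g              ≈⟨ comm _ _ ⟩
        b ·ℕ g ∙ (a ·ℕ g) ⁻¹              ∎)
    }

  multiple⊎inverse-multiple : ∀ {x} → Subgroup.contains multiples x →
                              ∃ λ n → x ≈ n ·ℕ g ⊎ x ⁻¹ ≈ n ·ℕ g
  multiple⊎inverse-multiple {x} (a , b , eq) with ℕ.≤-total b a
  ... | inj₁ b≤a with k , ≡.refl ← ℕ.m≤n⇒∃[o]m+o≡n b≤a =
    k , inj₁ (trans eq (multiple-difference b k))
  ... | inj₂ a≤b with k , ≡.refl ← ℕ.m≤n⇒∃[o]m+o≡n a≤b =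
    k , inj₂ (trans (proj₂ (proj₂ (Subgroup.⁻¹-closed multiples (a , b , eq))))
          (multiple-difference a k))

-- Subgroups of finitely generated abelian groups

module _ (em : ∀ a → ExcludedMiddle a) where

  least : {P : ℕ → Set p} → ∃ P → ∃ λ d → P d × (∀ n → P n → d ℕ.≤ n)
  least {P = P} (n , Pn) = <-rec (λ n → P n → Least) step n Pn
    where
    Least = ∃ λ d → P d × (∀ n → P n → d ℕ.≤ n)
    step : ∀ n → (∀ {k} → k ℕ.< n → P k → Least) → P n → Least
    step n rec Pn with em _ {∃ λ k → k ℕ.< n × P k}
    ... | yes (k , k<n , Pk) = rec k<n Pk
    ... | no none = n , Pn , λ k Pk → ℕ.≮⇒≥ λ k<n → none (k , k<n , Pk)

  -- Modulo ⟨g₁, …, g_{k-1}⟩, every element of K is up to sign a multiple of g₀;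
  -- a generator of K for the least positive multiple, together with generators
  -- of K ∩ ⟨g₁, …, g_{k-1}⟩, generates K.
  subgroup-finitelyGenerated :
    (Γ : AbelianGroup c ℓ) → ∀ k (g : Vector (AbelianGroup.Carrier Γ) k)
    (K : Subgroup Γ p) → (∀ {x} → Subgroup.contains K x → Generated Γ g x) →
    ∃ λ m → Σ (Vector (AbelianGroup.Carrier Γ) m) λ h →
    (∀ i → Subgroup.contains K (h i)) × (∀ {x} → Subgroup.contains K x → Generated Γ h x)
  subgroup-finitelyGenerated Γ zero    g K K⊆⟨g⟩ = 0 , (λ ()) , (λ ()) , λ x∈K →
    Generated-least Γ (span Γ _) (λ ()) (K⊆⟨g⟩ x∈K)
  subgroup-finitelyGenerated Γ (suc k) g K K⊆⟨g⟩ = from-multiples (em _)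
    where
    open AbelianGroup Γ hiding (_≈_)
    open GroupProperties group using (⁻¹-involutive; //-rightDividesˡ)
    open Subgroup K renaming (resp to K-resp)
    tail = span Γ (g ∘ suc)
    module Q = AbelianGroup (Γ / tail)
    open Q using (_≈_)
    open Mult Q.commutativeMonoid using () renaming (_×_ to _·ℕ_)

    g₀ : Carrier
    g₀ = g zero

    K∩tail : Subgroup Γ _
    K∩tail = record
      { contains  = λ x → contains x × Generated Γ (g ∘ suc) x
      ; resp      = λ x≈y (x∈K , gx) → K-resp x≈y x∈K , resp x≈y gx
      ; ε-closed  = ε-closed , unit
      ; ∙-closed  = λ (x∈K , gx) (y∈K , gy) → ∙-closed x∈K y∈K , mult gx gy
      ; ⁻¹-closed = λ (x∈K , gx) → ⁻¹-closed x∈K , inv gx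
      }

    tail-generators = subgroup-finitelyGenerated Γ k (g ∘ suc) K∩tail proj₂
    m = proj₁ tail-generators
    h : Vector Carrier m
    h = proj₁ (proj₂ tail-generators)
    h∈K : ∀ i → contains (h i)
    h∈K = proj₁ ∘ proj₁ (proj₂ (proj₂ tail-generators))
    h-generates : ∀ {x} → contains x × Generated Γ (g ∘ suc) x → Generated Γ h x
    h-generates = proj₂ (proj₂ (proj₂ tail-generators))

    -- Modulo `tail` every generator except g₀ becomes trivial. The subgroup of the quotient is
    -- pulled back to Γ so that induction on the span applies.
    is-multiple : ∀ {x} → Generated Γ g x → Subgroup.contains (multiples (Γ / tail) g₀) x
    is-multiple = Generated-least Γ (preimage (multiples (Γ / tail) g₀)) λ
      { zero    → 1 , 0 , Q.sym (Q.trans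
          (Q.∙-cong (Q.identityʳ g₀) (GroupProperties.ε⁻¹≈ε Q.group)) (Q.identityʳ g₀))
      ; (suc i) → Subgroup.resp (multiples (Γ / tail) g₀)
          (Q.sym (contains⇒≈ε Γ tail (gen i))) (Subgroup.ε-closed (multiples (Γ / tail) g₀))
      }
      where
      preimage : Subgroup (Γ / tail) p → Subgroup Γ p
      preimage H = record
        { contains  = Subgroup.contains H
        ; resp      = λ x≈y → Subgroup.resp H (GroupHomomorphism.⟦⟧-cong (projection Γ tail) x≈y)
        ; ε-closed  = Subgroup.ε-closed H
        ; ∙-closed  = Subgroup.∙-closed H
        ; ⁻¹-closed = Subgroup.⁻¹-closed H
        }

    Result : Set _
    Result = ∃ λ m → Σ (Vector Carrier m) λ h →
      (∀ i → contains (h i)) × (∀ {x} → contains x → Generated Γ h x)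

    conclude : ∀ {m} (h : Vector Carrier m) → (∀ i → contains (h i)) →
               (∀ n {x} → contains x → x ≈ n ·ℕ g₀ → Generated Γ h x) → Result
    conclude h h∈K generates = _ , h , h∈K , λ x∈K →
      case-sign x∈K (multiple⊎inverse-multiple (Γ / tail) g₀ (is-multiple (K⊆⟨g⟩ x∈K)))
      where
      case-sign : ∀ {x} → contains x → (∃ λ n → x ≈ n ·ℕ g₀ ⊎ x ⁻¹ ≈ n ·ℕ g₀) → Generated Γ h x
      case-sign x∈K (n , inj₁ eq) = generates n x∈K eq
      case-sign x∈K (n , inj₂ eq) =
        resp (⁻¹-involutive _) (inv (generates n (⁻¹-closed x∈K) eq))

    Multiple : ℕ → Set _
    Multiple n = ∃ λ x → contains x × x ≈ suc n ·ℕ g₀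

    from-multiples : Dec (∃ Multiple) → Result
    -- Without a positive multiple of g₀, only the multiple 0 occurs, so K lies in `tail`.
    from-multiples (no none) = conclude h h∈K λ
      { zero    x∈K eq → h-generates (x∈K , ≈ε⇒contains Γ tail eq)
      ; (suc n) x∈K eq → contradiction (n , _ , x∈K , eq) none
      }
    from-multiples (yes some) with d , (y , y∈K , y≈) , d-least ← least some =
      conclude (y V.∷ h) (λ { zero → y∈K ; (suc i) → h∈K i }) (<-rec Generates step)
      where
      Generates : ℕ → Set _
      Generates n = ∀ {x} → contains x → x ≈ n ·ℕ g₀ → Generated Γ (y V.∷ h) x

      step : ∀ n → (∀ {k} → k ℕ.< n → Generates k) → Generates n
      step zero    rec x∈K eq = Generated-least Γ (span Γ (y V.∷ h)) (gen ∘ suc)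
        (h-generates (x∈K , ≈ε⇒contains Γ tail eq))
      step (suc n) rec {x} x∈K eq
        -- Division with remainder by repeated subtraction: y is (d + 1)g₀ and x is (d + 1 + k)g₀
        -- modulo `tail`, so x - y is kg₀ with a smaller factor.
        with k , ≡.refl ← ℕ.m≤n⇒∃[o]m+o≡n (d-least n (x , x∈K , eq)) =
        resp (//-rightDividesˡ y x) (mult
          (rec (ℕ.s≤s (ℕ.m≤n+m k d)) (∙-closed x∈K (⁻¹-closed y∈K))
            (Q.trans (Q.∙-cong eq (Q.⁻¹-cong y≈)) (multiple-difference (Γ / tail) g₀ (suc d) k)))
          (gen zero))

-- Homomorphisms from a group generated by finitely many torsion elements

module _ (Λ : AbelianGroup c ℓ) where
  open AbelianGroup Λ
  open Mult commutativeMonoid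
    using (×-congʳ; ×-congˡ; ×-assocˡ; ×-idem) renaming (_×_ to _·ℕ_)

  multiple-exponent : ∀ k d {x} → NonZero k → d ·ℕ x ≈ ε → (k ℕ.* d) ·ℕ x ≈ ε
  multiple-exponent k d {x} k≢0 dx≈ε = trans (sym (×-assocˡ x k d))
    (trans (×-congʳ k dx≈ε) (×-idem (identityˡ ε) k {{k≢0}}))

  common-exponent : ∀ {m} (v : Vector Carrier m) → (∀ i → IsTorsion Λ (v i)) →
                    ∃ λ d → NonZero d × (∀ i → d ·ℕ v i ≈ ε)
  common-exponent {zero}  v v-torsion = 1 , _ , λ ()
  common-exponent {suc m} v v-torsion =
    let d , d≢0 , dv₀≈ε = v-torsion zero
        e , e≢0 , ev≈ε  = common-exponent (v ∘ suc) (v-torsion ∘ suc)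
    in e ℕ.* d , ℕ.m*n≢0 e d {{e≢0}} {{d≢0}} , λ
      { zero    → multiple-exponent e d e≢0 dv₀≈ε
      ; (suc i) → trans (×-congˡ (ℕ.*-comm e d)) (multiple-exponent d e d≢0 (ev≈ε i))
      }

funToFin-cong : ∀ {m n} {f g : Fin m → Fin n} → (∀ i → f i ≡ g i) → funToFin f ≡ funToFin g
funToFin-cong {zero}  f≗g = ≡.refl
funToFin-cong {suc m} f≗g = ≡.cong₂ combine (f≗g zero) (funToFin-cong (f≗g ∘ suc))

-- A common exponent d of the generators puts all their images into G[d]. The tuple of these images,
-- coded as one number below (#G[d])^m, determines the homomorphism because an equalizer containing
-- the generators is everything.
Hom-injection : (Λ : AbelianGroup c ℓ) {m : ℕ} (v : Vector (AbelianGroup.Carrier Λ) m) →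
  (∀ i → IsTorsion Λ (v i)) → (∀ x → Generated Λ v x) →
  (G : AbelianGroup c′ ℓ′) → TorsionWiseFinite G →
  ∃ λ N → Injection (Hom Λ G) (≡.setoid (Fin N))
Hom-injection Λ v v-torsion v-generates G G-finite = _ , record
  { to        = λ φ → funToFin (values φ)
  ; cong      = λ {φ} {ψ} φ≈ψ → funToFin-cong (λ i → kernel-d.to-cong (φ≈ψ (v i)))
  ; injective = λ {φ} {ψ} eq x → Generated-least Λ (equalizer Λ G φ ψ)
      (λ i → values-injective φ ψ i
        (≡.trans (≡.sym (finToFun-funToFin (values φ) i))
          (≡.trans (≡.cong (λ j → finToFun j i) eq) (finToFun-funToFin (values ψ) i))))
      (v-generates x)
  }
  where
  module G = AbelianGroup G
  open GroupHomomorphism using (⟦_⟧; ⟦⟧-cong; ε-homo)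
  exponent = common-exponent Λ v v-torsion
  d = proj₁ exponent
  finite = G-finite d (proj₁ (proj₂ exponent))
  module kernel-d = Inverse (proj₂ finite)

  value : Setoid.Carrier (Hom Λ G) → ∀ i → Setoid.Carrier (kernel G d)
  value φ i = ⟦ φ ⟧ (v i) , G.trans (G.sym (×-homo Λ G φ d (v i)))
    (G.trans (⟦⟧-cong φ (proj₂ (proj₂ exponent) i)) (ε-homo φ))

  values : Setoid.Carrier (Hom Λ G) → ∀ i → Fin (proj₁ finite)
  values φ i = kernel-d.to (value φ i)

  values-injective : ∀ φ ψ i → values φ i ≡ values ψ i → ⟦ φ ⟧ (v i) G.≈ ⟦ ψ ⟧ (v i)
  values-injective φ ψ i eq = G.trans (G.sym (kernel-d.strictlyInverseʳ (value φ i)))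
    (kernel-d.inverseʳ {value ψ i} eq)

torsion-toGroup : (Γ : AbelianGroup c ℓ) (K : Subgroup Γ p) →
  ∀ {x} → IsTorsion Γ x → (x∈K : Subgroup.contains K x) → IsTorsion (toGroup Γ K) (x , x∈K)
torsion-toGroup Γ K (d , d≢0 , dx≈ε) x∈K =
  d , d≢0 , AbelianGroup.trans Γ (×-homo (toGroup Γ K) Γ (inclusion Γ K) d _) dx≈ε

-- Values of cardinalities and ranks

module _ (em : ∀ a → ExcludedMiddle a) where
  open Classical em

  Hom-torsion-cardinality :
    (Γ : AbelianGroup c ℓ) → FinitelyGenerated Γ →
    (G : AbelianGroup c′ ℓ′) → TorsionWiseFinite G →
    ∃ (HasCardinality (Hom (Γ tor) G))
  Hom-torsion-cardinality Γ (k , g , g-generates) G G-finite =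
    let m , h , h-torsion , h-generates =
          subgroup-finitelyGenerated em Γ k g (torsion Γ) (λ {x} _ → g-generates x)
        N , f = Hom-injection (Γ tor) (λ i → h i , h-torsion i)
          (λ i → torsion-toGroup Γ (torsion Γ) (h-torsion i) (h-torsion i))
          (λ (x , t) → Generated-toGroup Γ (torsion Γ) h-torsion (h-generates t) t)
          G G-finite
    -- Not every tuple of values extends to a homomorphism; excluded middle singles out those that
    -- do.
    in _ , image-cardinality f (λ j → em _ {∃ λ φ → Injection.to f φ ≡ j})
             (λ φ → φ , ≡.refl) (λ x → x)

  #-unique : {X : Setoid a ℓ} {n : ℕ} → HasCardinality X n → # X ≡ n
  #-unique {X = X} X↔n with em _ {∃ (HasCardinality X)}
  ... | yes (m , X↔m) = hasCardinality-unique X↔m X↔n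
  ... | no none       = contradiction (_ , X↔n) none

  torsion-rank : (H : AbelianGroup c ℓ) → (∀ x → IsTorsion H x) → rank H ≡ 0
  torsion-rank H H-torsion with em _ {∃ (IsRank H)}
  -- Here `the` takes its default value 0, in agreement with the claim.
  ... | no _                            = ≡.refl
  ... | yes (zero , _)                  = ≡.refl
  -- The first of the independent vectors is killed by some d > 0, which gives the nontrivial
  -- relation (d, 0, ..., 0).
  ... | yes (suc r , (v , independent) , _) =
    contradiction (independent relation relation-holds zero)
      (d≢0⇒+d≢0 (proj₁ (proj₂ (H-torsion (v zero)))))
    where
    open AbelianGroup H
    open MonoidSum monoid using (sum-replicate-zero) renaming (sum to ∑H)
    d = proj₁ (H-torsion (v zero))
    relation : Vector ℤ (suc r)
    relation zero    = + d
    relation (suc _) = + 0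

    relation-holds : ∑H (λ i → _·_ H (relation i) (v i)) ≈ ε
    relation-holds =
      trans (∙-cong (proj₂ (proj₂ (H-torsion (v zero)))) (sum-replicate-zero r)) (identityˡ ε)

    d≢0⇒+d≢0 : ∀ {d} → NonZero d → + d ≢ + 0
    d≢0⇒+d≢0 {suc _} _ ()

-- Integer sums over lists

open ≡.≡-Reasoning

Σℤ : {A : Set a} → List A → (A → ℤ) → ℤ
Σℤ xs f = foldr ℤ._+_ (+ 0) (map f xs)

module _ {A : Set a} where

  Σℤ-cong : ∀ xs {f g : A → ℤ} → (∀ x → f x ≡ g x) → Σℤ xs f ≡ Σℤ xs g
  Σℤ-cong xs f≗g = ≡.cong (foldr ℤ._+_ (+ 0)) (map-cong f≗g xs)

  Σℤ-++ : ∀ xs ys (f : A → ℤ) → Σℤ (xs ++ ys) f ≡ Σℤ xs f ℤ.+ Σℤ ys f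
  Σℤ-++ []       ys f = ≡.sym (ℤ.+-identityˡ _)
  Σℤ-++ (x ∷ xs) ys f =
    ≡.trans (≡.cong (ℤ._+_ (f x)) (Σℤ-++ xs ys f)) (≡.sym (ℤ.+-assoc (f x) _ _))

  Σℤ-map : {B : Set b} (h : B → A) (xs : List B) (f : A → ℤ) → Σℤ (map h xs) f ≡ Σℤ xs (f ∘ h)
  Σℤ-map h xs f = ≡.cong (foldr ℤ._+_ (+ 0)) (≡.sym (map-∘ xs))

  Σℤ-+ : ∀ xs (f g : A → ℤ) → Σℤ xs (λ x → f x ℤ.+ g x) ≡ Σℤ xs f ℤ.+ Σℤ xs g
  Σℤ-+ []       f g = ≡.refl
  Σℤ-+ (x ∷ xs) f g = ≡.trans (≡.cong (ℤ._+_ (f x ℤ.+ g x)) (Σℤ-+ xs f g))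
    (interchange (f x) (g x) _ _)
    where open CommutativeSemigroupProperties ℤ.+-commutativeSemigroup using (interchange)

  Σℤ-*ʳ : ∀ xs (f : A → ℤ) k → Σℤ xs (λ x → f x ℤ.* k) ≡ Σℤ xs f ℤ.* k
  Σℤ-*ʳ []       f k = ≡.refl
  Σℤ-*ʳ (x ∷ xs) f k = ≡.trans (≡.cong (ℤ._+_ (f x ℤ.* k)) (Σℤ-*ʳ xs f k))
    (≡.sym (ℤ.*-distribʳ-+ k (f x) _))

  Σℤ-zero : ∀ xs {f : A → ℤ} → (∀ {x} → x ∈ xs → f x ≡ + 0) → Σℤ xs f ≡ + 0
  Σℤ-zero []       f≡0 = ≡.refl
  Σℤ-zero (x ∷ xs) f≡0 = ≡.cong₂ ℤ._+_ (f≡0 (here ≡.refl)) (Σℤ-zero xs (f≡0 ∘ there))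

  Σℤ-neg : ∀ xs (f : A → ℤ) → Σℤ xs (λ x → ℤ.- f x) ≡ ℤ.- Σℤ xs f
  Σℤ-neg []       f = ≡.refl
  Σℤ-neg (x ∷ xs) f =
    ≡.trans (≡.cong (ℤ._+_ (ℤ.- f x)) (Σℤ-neg xs f)) (≡.sym (ℤ.neg-distrib-+ (f x) _))

  Σℤ-nonNegative : ∀ xs {f : A → ℤ} → (∀ x → + 0 ℤ.≤ f x) → + 0 ℤ.≤ Σℤ xs f
  Σℤ-nonNegative []       0≤f = ℤ.≤-refl
  Σℤ-nonNegative (x ∷ xs) 0≤f = ℤ.+-mono-≤ (0≤f x) (Σℤ-nonNegative xs 0≤f)

Σℤ-swap : {A : Set a} {B : Set b} (xs : List A) (ys : List B) (f : A → B → ℤ) →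
          Σℤ xs (λ x → Σℤ ys (f x)) ≡ Σℤ ys (λ y → Σℤ xs (λ x → f x y))
Σℤ-swap []       ys f = ≡.sym (Σℤ-zero ys (λ _ → ≡.refl))
Σℤ-swap (x ∷ xs) ys f = ≡.trans (≡.cong (ℤ._+_ (Σℤ ys (f x))) (Σℤ-swap xs ys f))
  (≡.sym (Σℤ-+ ys (f x) _))

-- Indicators and double counting

𝟙 : {P : Set p} → Dec P → ℤ
𝟙 P? = if does P? then + 1 else + 0

module _ {A : Set a} {P : Pred A p} (P? : Decidable P) where

  length-filter-Σℤ : ∀ xs → + length (filter P? xs) ≡ Σℤ xs (λ x → 𝟙 (P? x))
  length-filter-Σℤ []       = ≡.refl
  length-filter-Σℤ (x ∷ xs) with P? x
  ... | yes _ = ≡.cong (ℤ._+_ (+ 1)) (length-filter-Σℤ xs)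
  ... | no  _ = ≡.trans (length-filter-Σℤ xs) (≡.sym (ℤ.+-identityˡ _))

  sum-filter-Σℤ : ∀ (w : A → ℕ) xs →
    + sum (map w (filter P? xs)) ≡ Σℤ xs (λ x → 𝟙 (P? x) ℤ.* + w x)
  sum-filter-Σℤ w []       = ≡.refl
  sum-filter-Σℤ w (x ∷ xs) with P? x
  ... | yes _ = ≡.cong₂ ℤ._+_ (≡.sym (ℤ.*-identityˡ (+ w x))) (sum-filter-Σℤ w xs)
  ... | no  _ = ≡.trans (sum-filter-Σℤ w xs) (≡.sym (ℤ.+-identityˡ _))

Σℤ-select : {A : Set a} (_≟_ : DecidableEquality A) {xs : List A} → Unique xs →
            ∀ {x} → x ∈ xs → (f : A → ℤ) → Σℤ xs (λ y → 𝟙 (x ≟ y) ℤ.* f y) ≡ f x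
Σℤ-select _≟_ {x ∷ xs} (x∉ ∷ _) (here ≡.refl) f with x ≟ x
... | no x≢x = contradiction ≡.refl x≢x
... | yes _  = ≡.trans (≡.cong₂ ℤ._+_ (ℤ.*-identityˡ (f x)) (Σℤ-zero xs others))
                       (ℤ.+-identityʳ (f x))
  where
  others : ∀ {y} → y ∈ xs → 𝟙 (x ≟ y) ℤ.* f y ≡ + 0
  others {y} y∈xs with x ≟ y
  ... | yes x≡y = contradiction x≡y (All.lookup x∉ y∈xs)
  ... | no _    = ≡.refl
Σℤ-select _≟_ {y ∷ xs} (y∉ ∷ u) {x} (there x∈xs) f with x ≟ y
... | yes x≡y = contradiction (≡.sym x≡y) (All.lookup y∉ x∈xs)
... | no _    = ≡.trans (ℤ.+-identityˡ _) (Σℤ-select _≟_ u x∈xs f)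

-- Double counting of related pairs. It is applied to subsets S and homomorphisms φ, with S ⊆ Z(φ)
-- on the Tutte side and Z(φ) = S on the other.
Σℤ-count : {A : Set a} {B : Set b} {R : A → B → Set p} (R? : ∀ x y → Dec (R x y))
  (xs : List A) (ys : List B) (f : A → ℤ) →
  Σℤ xs (λ x → + length (filter (R? x) ys) ℤ.* f x) ≡
  Σℤ ys (λ y → Σℤ xs (λ x → 𝟙 (R? x y) ℤ.* f x))
Σℤ-count R? xs ys f = begin
  Σℤ xs (λ x → + length (filter (R? x) ys) ℤ.* f x)
    ≡⟨ Σℤ-cong xs (λ x → ≡.cong (ℤ._* f x) (length-filter-Σℤ (R? x) ys)) ⟩
  Σℤ xs (λ x → Σℤ ys (λ y → 𝟙 (R? x y)) ℤ.* f x)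
    ≡⟨ Σℤ-cong xs (λ x → Σℤ-*ʳ ys (λ y → 𝟙 (R? x y)) (f x)) ⟨
  Σℤ xs (λ x → Σℤ ys (λ y → 𝟙 (R? x y) ℤ.* f x))
    ≡⟨ Σℤ-swap xs ys (λ x y → 𝟙 (R? x y) ℤ.* f x) ⟩
  Σℤ ys (λ y → Σℤ xs (λ x → 𝟙 (R? x y) ℤ.* f x)) ∎

-- Undoes the grouping of subsets by size: each x contributes for exactly one k, since `ks` contains
-- `h x` once.
Σℤ-fibres : {A : Set a} (h w : A → ℕ) (xs : List A) {ks : List ℕ} → Unique ks →
  (∀ x → h x ∈ ks) → (f : ℕ → ℤ) →
  Σℤ ks (λ k → + sum (map w (filter (λ x → h x ℕ.≟ k) xs)) ℤ.* f k) ≡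
  Σℤ xs (λ x → + w x ℤ.* f (h x))
Σℤ-fibres h w xs {ks} unique h∈ks f = begin
  Σℤ ks (λ k → + sum (map w (filter (λ x → h x ℕ.≟ k) xs)) ℤ.* f k)
    ≡⟨ Σℤ-cong ks (λ k → ≡.trans
         (≡.cong (ℤ._* f k) (sum-filter-Σℤ (λ x → h x ℕ.≟ k) w xs))
         (≡.sym (Σℤ-*ʳ xs _ (f k)))) ⟩
  Σℤ ks (λ k → Σℤ xs (λ x → 𝟙 (h x ℕ.≟ k) ℤ.* + w x ℤ.* f k))
    ≡⟨ Σℤ-swap ks xs (λ k x → 𝟙 (h x ℕ.≟ k) ℤ.* + w x ℤ.* f k) ⟩
  Σℤ xs (λ x → Σℤ ks (λ k → 𝟙 (h x ℕ.≟ k) ℤ.* + w x ℤ.* f k))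
    ≡⟨ Σℤ-cong xs (λ x → Σℤ-cong ks (λ k → ℤ.*-assoc (𝟙 (h x ℕ.≟ k)) (+ w x) (f k))) ⟩
  Σℤ xs (λ x → Σℤ ks (λ k → 𝟙 (h x ℕ.≟ k) ℤ.* (+ w x ℤ.* f k)))
    ≡⟨ Σℤ-cong xs (λ x → Σℤ-select ℕ._≟_ unique (h∈ks x) (λ k → + w x ℤ.* f k)) ⟩
  Σℤ xs (λ x → + w x ℤ.* f (h x)) ∎

-- Enumerating subsets

∈-subsets : ∀ {n} (S : Subset n) → S ∈ subsets n
∈-subsets Vec.[]              = here ≡.refl
∈-subsets (outside Vec.∷ S) = ∈-++⁺ˡ (∈-map⁺ (outside Vec.∷_) (∈-subsets S))
∈-subsets (inside  Vec.∷ S) =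
  ∈-++⁺ʳ (map (outside Vec.∷_) (subsets _)) (∈-map⁺ (inside Vec.∷_) (∈-subsets S))

subsets-unique : ∀ n → Unique (subsets n)
subsets-unique zero    = All.[] ∷ []
subsets-unique (suc n) = Unique.++⁺
  (Unique.map⁺ ∷-injectiveʳ (subsets-unique n))
  (Unique.map⁺ ∷-injectiveʳ (subsets-unique n))
  λ (∈out , ∈in) → outside∉inside (∈-map⁻ _ ∈out) (∈-map⁻ _ ∈in)
  where
  outside∉inside : ∀ {S : Subset (suc n)} →
    ∃ (λ T → T ∈ subsets n × S ≡ outside Vec.∷ T) → ¬ ∃ (λ T → T ∈ subsets n × S ≡ inside Vec.∷ T)
  outside∉inside (_ , _ , ≡.refl) (_ , _ , ())

-- Coefficients of polynomials

open Defs using (_≈_; _+_; _*_; -_; 1#; _^_)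

module _ {R : RawRing c ℓ} where
  open RawRing R using () renaming (_+_ to _+R_; 0# to 0R)

  module _ (+-identityˡ : ∀ x → 0R +R x ≡ x) (+-identityʳ : ∀ x → x +R 0R ≡ x) where

    -- The identity laws are taken up to `≡`, which holds in ℤ and also for `addPoly` on lists, so
    -- the lemma covers both levels of (ℤ[y])[x].
    coefficient-addPoly : ∀ p q i →
      coefficient R (addPoly R p q) i ≡ coefficient R p i +R coefficient R q i
    coefficient-addPoly []      q       i       = ≡.sym (+-identityˡ _)
    coefficient-addPoly (a ∷ p) []      i       = ≡.sym (+-identityʳ _)
    coefficient-addPoly (a ∷ p) (b ∷ q) zero    = ≡.refl
    coefficient-addPoly (a ∷ p) (b ∷ q) (suc i) = coefficient-addPoly p q i

ℤraw : RawRing _ _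
ℤraw = ℤ.+-*-rawRing

coefficient-+ : ∀ p q j →
  coefficient ℤraw (addPoly ℤraw p q) j ≡ coefficient ℤraw p j ℤ.+ coefficient ℤraw q j
coefficient-+ = coefficient-addPoly ℤ.+-identityˡ ℤ.+-identityʳ

coeff-+ : ∀ P Q i j →
  (coeff-x^ i y^ j) (P + Q) ≡ (coeff-x^ i y^ j) P ℤ.+ (coeff-x^ i y^ j) Q
coeff-+ P Q i j = ≡.trans
  (≡.cong (λ p → coefficient ℤraw p j)
    (coefficient-addPoly {R = ℤ[y]} (λ _ → ≡.refl) addPoly-identityʳ P Q i))
  (coefficient-+ (coefficient ℤ[y] P i) (coefficient ℤ[y] Q i) j)
  where
  addPoly-identityʳ : ∀ p → addPoly ℤraw p [] ≡ p
  addPoly-identityʳ []      = ≡.refl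
  addPoly-identityʳ (_ ∷ _) = ≡.refl

coeff-∑ : {A : Set a} (xs : List A) (f : A → Polynomial) → ∀ i j →
  (coeff-x^ i y^ j) (∑ xs f) ≡ Σℤ xs (λ x → (coeff-x^ i y^ j) (f x))
coeff-∑ []       f i j = ≡.refl
coeff-∑ (x ∷ xs) f i j =
  ≡.trans (coeff-+ (f x) (∑ xs f) i j) (≡.cong (ℤ._+_ ((coeff-x^ i y^ j) (f x))) (coeff-∑ xs f i j))

coeff-·ₚ : ∀ n P i j → (coeff-x^ i y^ j) (n ·ₚ P) ≡ + n ℤ.* (coeff-x^ i y^ j) P
coeff-·ₚ zero    P i j = ≡.refl
coeff-·ₚ (suc n) P i j = begin
  coeff (P + n ·ₚ P)                ≡⟨ coeff-+ P (n ·ₚ P) i j ⟩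
  coeff P ℤ.+ coeff (n ·ₚ P)        ≡⟨ ≡.cong (ℤ._+_ (coeff P)) (coeff-·ₚ n P i j) ⟩
  coeff P ℤ.+ + n ℤ.* coeff P       ≡⟨ ℤ.suc-* (+ n) (coeff P) ⟨
  + suc n ℤ.* coeff P               ∎
  where coeff = coeff-x^ i y^ j

coefficient-map-* : ∀ a p j → coefficient ℤraw (map (a ℤ.*_) p) j ≡ a ℤ.* coefficient ℤraw p j
coefficient-map-* a []      j       = ≡.sym (ℤ.*-zeroʳ a)
coefficient-map-* a (b ∷ p) zero    = ≡.refl
coefficient-map-* a (b ∷ p) (suc j) = coefficient-map-* a p j

-- The product is a list of zeros as long as `q`, equal to `[]` only coefficientwise.
coefficient-*-[] : ∀ q j → coefficient ℤraw (mulPoly ℤraw q []) j ≡ + 0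
coefficient-*-[] []      j       = ≡.refl
coefficient-*-[] (a ∷ q) zero    = ≡.refl
coefficient-*-[] (a ∷ q) (suc j) = coefficient-*-[] q j

coefficient-∷-* : ∀ a q p j → coefficient ℤraw (mulPoly ℤraw (a ∷ q) p) j ≡
  a ℤ.* coefficient ℤraw p j ℤ.+ coefficient ℤraw (+ 0 ∷ mulPoly ℤraw q p) j
coefficient-∷-* a q p j = ≡.trans (coefficient-+ (map (a ℤ.*_) p) _ j)
  (≡.cong (ℤ._+ coefficient ℤraw (+ 0 ∷ mulPoly ℤraw q p) j) (coefficient-map-* a p j))

coefficient-[a]-* : ∀ a p j →
  coefficient ℤraw (mulPoly ℤraw (a ∷ []) p) j ≡ a ℤ.* coefficient ℤraw p j
coefficient-[a]-* a p j = ≡.trans (coefficient-∷-* a [] p j)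
  (≡.trans (≡.cong (ℤ._+_ (a ℤ.* coefficient ℤraw p j)) (0∷[] j)) (ℤ.+-identityʳ _))
  where
  0∷[] : ∀ j → coefficient ℤraw (+ 0 ∷ []) j ≡ + 0
  0∷[] zero    = ≡.refl
  0∷[] (suc j) = ≡.refl

-- A factor free of x acts on each x-coefficient separately. With all ranks 0, every factor that
-- remains (`1#`, `𝕪`, `𝕪 + - 1#`) has this form.
coeff-constant-* : ∀ q P i j →
  (coeff-x^ i y^ j) ((q ∷ []) * P) ≡ coefficient ℤraw (mulPoly ℤraw q (coefficient ℤ[y] P i)) j
coeff-constant-* q P i j = begin
  (coeff-x^ i y^ j) ((q ∷ []) * P)
    ≡⟨ coeff-+ (map (mulPoly ℤraw q) P) ([] ∷ []) i j ⟩
  (coeff-x^ i y^ j) (map (mulPoly ℤraw q) P) ℤ.+ (coeff-x^ i y^ j) ([] ∷ [])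
    ≡⟨ ≡.cong₂ ℤ._+_ (coeff-map P i) ([]∷[] i) ⟩
  coefficient ℤraw (mulPoly ℤraw q (coefficient ℤ[y] P i)) j ℤ.+ + 0
    ≡⟨ ℤ.+-identityʳ _ ⟩
  coefficient ℤraw (mulPoly ℤraw q (coefficient ℤ[y] P i)) j ∎
  where
  coeff-map : ∀ P i → (coeff-x^ i y^ j) (map (mulPoly ℤraw q) P) ≡
                      coefficient ℤraw (mulPoly ℤraw q (coefficient ℤ[y] P i)) j
  coeff-map []      i       = ≡.sym (coefficient-*-[] q j)
  coeff-map (p ∷ P) zero    = ≡.refl
  coeff-map (p ∷ P) (suc i) = coeff-map P i

  []∷[] : ∀ i → (coeff-x^ i y^ j) ([] ∷ []) ≡ + 0
  []∷[] zero    = ≡.refl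
  []∷[] (suc i) = ≡.refl

coeff-1#-* : ∀ P i j → (coeff-x^ i y^ j) (1# * P) ≡ (coeff-x^ i y^ j) P
coeff-1#-* P i j = ≡.trans (coeff-constant-* (+ 1 ∷ []) P i j)
  (≡.trans (coefficient-[a]-* (+ 1) (coefficient ℤ[y] P i) j) (ℤ.*-identityˡ _))

-- The coefficient of Xʲ in X f, where f is the sequence of coefficients.
shift : (ℕ → ℤ) → ℕ → ℤ
shift f zero    = + 0
shift f (suc j) = f j

coeff-linear-* : ∀ a b P i j → (coeff-x^ i y^ j) (((a ∷ b ∷ []) ∷ []) * P) ≡
  a ℤ.* (coeff-x^ i y^ j) P ℤ.+ b ℤ.* shift (λ j → (coeff-x^ i y^ j) P) j
coeff-linear-* a b P i j = begin
  (coeff-x^ i y^ j) (((a ∷ b ∷ []) ∷ []) * P)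
    ≡⟨ coeff-constant-* (a ∷ b ∷ []) P i j ⟩
  coefficient ℤraw (mulPoly ℤraw (a ∷ b ∷ []) Pᵢ) j
    ≡⟨ coefficient-∷-* a (b ∷ []) Pᵢ j ⟩
  a ℤ.* coefficient ℤraw Pᵢ j ℤ.+ coefficient ℤraw (+ 0 ∷ mulPoly ℤraw (b ∷ []) Pᵢ) j
    ≡⟨ ≡.cong (ℤ._+_ (a ℤ.* coefficient ℤraw Pᵢ j)) (shifted j) ⟩
  a ℤ.* coefficient ℤraw Pᵢ j ℤ.+ b ℤ.* shift (coefficient ℤraw Pᵢ) j ∎
  where
  Pᵢ = coefficient ℤ[y] P i
  shifted : ∀ j → coefficient ℤraw (+ 0 ∷ mulPoly ℤraw (b ∷ []) Pᵢ) j ≡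
                  b ℤ.* shift (coefficient ℤraw Pᵢ) j
  shifted zero    = ≡.sym (ℤ.*-zeroʳ b)
  shifted (suc j) = coefficient-[a]-* b Pᵢ j

coeff-𝕪-* : ∀ P i j → (coeff-x^ i y^ j) (𝕪 * P) ≡ shift (λ j → (coeff-x^ i y^ j) P) j
coeff-𝕪-* P i j = ≡.trans (coeff-linear-* (+ 0) (+ 1) P i j)
  (≡.trans (ℤ.+-identityˡ _) (ℤ.*-identityˡ _))

coeff-[𝕪-1]-* : ∀ P i j → (coeff-x^ i y^ j) ((𝕪 + - 1#) * P) ≡
  ℤ.- (coeff-x^ i y^ j) P ℤ.+ shift (λ j → (coeff-x^ i y^ j) P) j
-- `𝕪 + - 1#` computes to `(ℤ.-1ℤ ∷ + 1 ∷ []) ∷ []`.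
coeff-[𝕪-1]-* P i j = ≡.trans (coeff-linear-* ℤ.-1ℤ (+ 1) P i j)
  (≡.cong₂ ℤ._+_ (ℤ.-1*i≡-i ((coeff-x^ i y^ j) P))
    (ℤ.*-identityˡ (shift (λ j → (coeff-x^ i y^ j) P) j)))

coeff-𝕪^-nonNegative : ∀ k i j → + 0 ℤ.≤ (coeff-x^ i y^ j) (𝕪 ^ k)
coeff-𝕪^-nonNegative zero    zero    zero    = ℤ.+≤+ ℕ.z≤n
coeff-𝕪^-nonNegative zero    zero    (suc j) = ℤ.≤-refl
coeff-𝕪^-nonNegative zero    (suc i) j       = ℤ.≤-refl
coeff-𝕪^-nonNegative (suc k) i j = ≡.subst (+ 0 ℤ.≤_) (≡.sym (coeff-𝕪-* (𝕪 ^ k) i j)) (0≤shift j)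
  where
  0≤shift : ∀ j → + 0 ℤ.≤ shift (λ j → (coeff-x^ i y^ j) (𝕪 ^ k)) j
  0≤shift zero    = ℤ.≤-refl
  0≤shift (suc j) = coeff-𝕪^-nonNegative k i j

coeff-x^suc-𝕪^ : ∀ k i j → (coeff-x^ suc i y^ j) (𝕪 ^ k) ≡ + 0
coeff-x^suc-𝕪^ zero    i j       = ≡.refl
coeff-x^suc-𝕪^ (suc k) i zero    = coeff-𝕪-* (𝕪 ^ k) (suc i) zero
coeff-x^suc-𝕪^ (suc k) i (suc j) =
  ≡.trans (coeff-𝕪-* (𝕪 ^ k) (suc i) (suc j)) (coeff-x^suc-𝕪^ k i j)

-- Each element of Z contributes a factor 1 + (y - 1) = y.
Σℤ-[𝕪-1]^ : ∀ {n} (Z : Subset n) i j →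
  Σℤ (subsets n) (λ S → 𝟙 (S ⊆? Z) ℤ.* (coeff-x^ i y^ j) ((𝕪 + - 1#) ^ ∣ S ∣)) ≡
  (coeff-x^ i y^ j) (𝕪 ^ ∣ Z ∣)
Σℤ-[𝕪-1]^ Vec.[] i j = ≡.trans (ℤ.+-identityʳ _) (ℤ.*-identityˡ _)
Σℤ-[𝕪-1]^ {suc n} (z Vec.∷ Z) i j = begin
  Σℤ (subsets (suc n)) (F (z Vec.∷ Z) j)
    ≡⟨ Σℤ-++ (map (outside Vec.∷_) (subsets n)) (map (inside Vec.∷_) (subsets n)) _ ⟩
  Σℤ (map (outside Vec.∷_) (subsets n)) (F (z Vec.∷ Z) j) ℤ.+
  Σℤ (map (inside Vec.∷_) (subsets n)) (F (z Vec.∷ Z) j)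
    ≡⟨ ≡.cong₂ ℤ._+_ (Σℤ-map (outside Vec.∷_) (subsets n) _) (Σℤ-map (inside Vec.∷_) (subsets n) _) ⟩
  -- Whether `outside ∷ S` lies in `z ∷ Z` is decided by the tails alone, so the first sum is
  -- definitionally the one for Z.
  Σℤ (subsets n) (F Z j) ℤ.+
  Σℤ (subsets n) (λ S → F (z Vec.∷ Z) j (inside Vec.∷ S))
    ≡⟨ ≡.cong (ℤ._+ Σℤ (subsets n) (λ S → F (z Vec.∷ Z) j (inside Vec.∷ S))) (Σℤ-[𝕪-1]^ Z i j) ⟩
  Y j ℤ.+ Σℤ (subsets n) (λ S → F (z Vec.∷ Z) j (inside Vec.∷ S))
    ≡⟨ new-element z ⟩
  (coeff-x^ i y^ j) (𝕪 ^ ∣ z Vec.∷ Z ∣) ∎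
  where
  F : ∀ {n} → Subset n → ℕ → Subset n → ℤ
  F Z j S = 𝟙 (S ⊆? Z) ℤ.* (coeff-x^ i y^ j) ((𝕪 + - 1#) ^ ∣ S ∣)

  Y : ℕ → ℤ
  Y j = (coeff-x^ i y^ j) (𝕪 ^ ∣ Z ∣)

  Σ-shift : ∀ j → Σℤ (subsets n) (λ S → 𝟙 (S ⊆? Z) ℤ.*
    shift (λ j → (coeff-x^ i y^ j) ((𝕪 + - 1#) ^ ∣ S ∣)) j) ≡ shift Y j
  Σ-shift zero    = Σℤ-zero (subsets n) (λ {S} _ → ℤ.*-zeroʳ (𝟙 (S ⊆? Z)))
  Σ-shift (suc j) = Σℤ-[𝕪-1]^ Z i j

  factor-𝕪-1 : ∀ S → F (inside Vec.∷ Z) j (inside Vec.∷ S) ≡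
    ℤ.- F Z j S ℤ.+ 𝟙 (S ⊆? Z) ℤ.* shift (λ j → (coeff-x^ i y^ j) ((𝕪 + - 1#) ^ ∣ S ∣)) j
  factor-𝕪-1 S = ≡.trans
    (≡.cong (𝟙 (S ⊆? Z) ℤ.*_) (coeff-[𝕪-1]-* ((𝕪 + - 1#) ^ ∣ S ∣) i j))
    (≡.trans (ℤ.*-distribˡ-+ (𝟙 (S ⊆? Z)) (ℤ.- e j) (shift e j))
      (≡.cong (ℤ._+ 𝟙 (S ⊆? Z) ℤ.* shift e j) (≡.sym (ℤ.neg-distribʳ-* (𝟙 (S ⊆? Z)) (e j)))))
    where
    e : ℕ → ℤ
    e j = (coeff-x^ i y^ j) ((𝕪 + - 1#) ^ ∣ S ∣)

  new-element : ∀ z → Y j ℤ.+ Σℤ (subsets n) (λ S → F (z Vec.∷ Z) j (inside Vec.∷ S)) ≡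
                      (coeff-x^ i y^ j) (𝕪 ^ ∣ z Vec.∷ Z ∣)
  -- No subset containing the new index lies in `outside ∷ Z`, so every indicator computes to 0.
  new-element outside = ≡.trans (≡.cong (ℤ._+_ (Y j)) (Σℤ-zero (subsets n) (λ _ → ≡.refl)))
    (ℤ.+-identityʳ (Y j))
  new-element inside  = begin
    Y j ℤ.+ Σℤ (subsets n) (λ S → F (inside Vec.∷ Z) j (inside Vec.∷ S))
      ≡⟨ ≡.cong (ℤ._+_ (Y j)) (≡.trans (Σℤ-cong (subsets n) factor-𝕪-1) (Σℤ-+ (subsets n) _ _)) ⟩
    Y j ℤ.+ (Σℤ (subsets n) (λ S → ℤ.- F Z j S) ℤ.+ _)
      ≡⟨ ≡.cong (ℤ._+_ (Y j)) (≡.cong₂ ℤ._+_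
           (≡.trans (Σℤ-neg (subsets n) (F Z j)) (≡.cong ℤ.-_ (Σℤ-[𝕪-1]^ Z i j)))
           (Σ-shift j)) ⟩
    Y j ℤ.+ (ℤ.- Y j ℤ.+ shift Y j)
      ≡⟨ ℤ.+-assoc (Y j) (ℤ.- Y j) (shift Y j) ⟨
    Y j ℤ.+ ℤ.- Y j ℤ.+ shift Y j
      ≡⟨ ≡.cong (ℤ._+ shift Y j) (ℤ.+-inverseʳ (Y j)) ⟩
    + 0 ℤ.+ shift Y j
      ≡⟨ ℤ.+-identityˡ (shift Y j) ⟩
    shift Y j
      ≡⟨ coeff-𝕪-* (𝕪 ^ ∣ Z ∣) i j ⟨
    (coeff-x^ i y^ j) (𝕪 ^ suc ∣ Z ∣) ∎

-- Counting homomorphisms by the set of elements of 𝓐 that they annihilate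

module _ (em : ∀ a → ExcludedMiddle a) (Δ : AbelianGroup c ℓ) (G : AbelianGroup c′ ℓ′) {N : ℕ}
         (Hom↔Fin : HasCardinality (Hom Δ G) N)
         {n : ℕ} (𝓐 : Vector (AbelianGroup.Carrier Δ) n) where
  private
    module G = AbelianGroup G
    module H = Inverse Hom↔Fin
  open GroupHomomorphism using (⟦_⟧)

  -- Z(φ) as a set of indices, for the homomorphism φ numbered j.
  zeros : Fin N → Subset n
  zeros j = Vec.tabulate λ i → does (em _ {⟦ H.from j ⟧ (𝓐 i) G.≈ G.ε})

  ∈-zeros⁺ : ∀ {j i} → ⟦ H.from j ⟧ (𝓐 i) G.≈ G.ε → i ∈ₛ zeros j
  ∈-zeros⁺ {j} {i} φ≈ε = lookup⇒[]= i (zeros j)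
    (≡.trans (lookup∘tabulate _ i) (dec-true (em _) φ≈ε))

  ∈-zeros⁻ : ∀ {j i} → i ∈ₛ zeros j → ⟦ H.from j ⟧ (𝓐 i) G.≈ G.ε
  ∈-zeros⁻ {j} {i} i∈ = does⇒ (em _) (≡.trans (≡.sym (lookup∘tabulate _ i)) ([]=⇒lookup i∈))
    where
    does⇒ : {P : Set p} (P? : Dec P) → does P? ≡ true → P
    does⇒ (yes x) _ = x

  module _ (Λ : AbelianGroup c″ ℓ″) {q : Setoid.Carrier (Hom Δ Λ)} (S : Subset n)
           (isQuotient : IsQuotient Δ Λ (restrict 𝓐 S) q) where

    -- A homomorphism on the quotient receives the number of its pullback to Δ; thus all S share the
    -- one enumeration of `Hom Δ G`.
    pullback-index : Injection (Hom Λ G) (≡.setoid (Fin N))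
    pullback-index = record
      { to        = λ ψ → H.to (pullback Δ Λ G q ψ)
      ; cong      = λ ψ≈ψ′ → H.to-cong (λ x → ψ≈ψ′ _)
      ; injective = λ {ψ} {ψ′} eq → pullback-injective Δ Λ G q isQuotient ψ ψ′ λ x →
          G.trans (G.sym (H.strictlyInverseʳ (pullback Δ Λ G q ψ) x))
            (H.inverseʳ {pullback Δ Λ G q ψ′} eq x)
      }

    private
      module index = Injection pullback-index

      index-value : ∀ ψ i → ⟦ H.from (index.to ψ) ⟧ (𝓐 i) G.≈ ⟦ pullback Δ Λ G q ψ ⟧ (𝓐 i)
      index-value ψ i = H.strictlyInverseʳ (pullback Δ Λ G q ψ) (𝓐 i)

      S⊆zeros : ∀ ψ → S ⊆ zeros (index.to ψ)
      S⊆zeros ψ {i} i∈S = ∈-zeros⁺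
        (G.trans (index-value ψ i) (pullback-vanishes Δ Λ G q isQuotient ψ (i , i∈S)))

      index-preimage : ∀ {j} → S ⊆ zeros j → ∃ λ ψ → index.to ψ ≡ j
      index-preimage {j} S⊆zeros =
        let ψ , ψ≈ = factor Δ Λ G q isQuotient (H.from j) (λ (_ , i∈S) → ∈-zeros⁻ (S⊆zeros i∈S))
        in ψ , ≡.trans (H.to-cong ψ≈) (H.strictlyInverseˡ j)

    Hom-quotient-cardinality :
      HasCardinality (Hom Λ G) (length (filter (λ j → S ⊆? zeros j) (allFin N)))
    Hom-quotient-cardinality =
      image-cardinality pullback-index (λ j → S ⊆? zeros j) S⊆zeros index-preimage

    -- A pullback kills S because it factors through the quotient, and it kills nothing else in 𝓐
    -- precisely when the homomorphism avoids the remaining cosets.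
    𝓜-quotient-cardinality :
      HasCardinality (𝓜 Λ (λ i → ⟦ q ⟧ (remove 𝓐 S i)) G)
        (length (filter (λ j → ≡-dec Bool._≟_ (zeros j) S) (allFin N)))
    𝓜-quotient-cardinality = image-cardinality
      (record
        { to = λ (ψ , _) → index.to ψ ; cong = λ {(ψ , _)} {(ψ′ , _)} → index.cong {ψ} {ψ′}
        ; injective = λ {(ψ , _)} {(ψ′ , _)} → index.injective {ψ} {ψ′} })
      (λ j → ≡-dec Bool._≟_ (zeros j) S)
      (λ (ψ , nonzero) → ⊆-antisym (zeros⊆S ψ nonzero) (S⊆zeros ψ))
      (λ { {j} ≡.refl →
        let ψ , ψ↦j = index-preimage {j} (λ i∈S → i∈S)
        in (ψ , λ (i , i∉S) ψ≈ε → i∉S (≡.subst (λ j → i ∈ₛ zeros j) ψ↦j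
             (∈-zeros⁺ (G.trans (index-value ψ i) ψ≈ε)))) , ψ↦j })
      where
      zeros⊆S : ∀ ψ → (∀ i → ¬ ⟦ ψ ⟧ (⟦ q ⟧ (remove 𝓐 S i)) G.≈ G.ε) → zeros (index.to ψ) ⊆ S
      zeros⊆S ψ nonzero {i} i∈zeros with i ∈? S
      ... | yes i∈S = i∈S
      ... | no  i∉S = contradiction
        (G.trans (G.sym (index-value ψ i)) (∈-zeros⁻ i∈zeros)) (nonzero (i , i∉S))

-- Comparison of the coefficients of the two polynomials

module _ (em : ∀ a → ExcludedMiddle a)
         (Γ : AbelianGroup c ℓ) (Γ-fg : FinitelyGenerated Γ)
         (G : AbelianGroup c′ ℓ′) (G-finite : TorsionWiseFinite G)
         {n : ℕ} (𝓐 : Vector (AbelianGroup.Carrier Γ) n)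
         (𝓐-torsion : ∀ i → IsTorsion Γ (𝓐 i)) where
  open Classical em

  private
    N : ℕ
    N = proj₁ (Hom-torsion-cardinality em Γ Γ-fg G G-finite)

    Hom↔Fin : HasCardinality (Hom (Γ tor) G) N
    Hom↔Fin = proj₂ (Hom-torsion-cardinality em Γ Γ-fg G G-finite)

    𝓐ₜ : Vector (AbelianGroup.Carrier (Γ tor)) n
    𝓐ₜ i = 𝓐 i , 𝓐-torsion i

  zeroSets : Fin N → Subset n
  zeroSets = zeros em (Γ tor) G Hom↔Fin 𝓐ₜ

  m≡ : ∀ S → m Γ 𝓐 S G ≡ length (filter (λ φ → S ⊆? zeroSets φ) (allFin N))
  m≡ S = #-unique em (Hom-quotient-cardinality em (Γ tor) G Hom↔Fin 𝓐ₜ ((Γ / span Γ (restrict 𝓐 S)) tor) S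
    (torsion-projection-isQuotient Γ (restrict 𝓐 S) (λ (i , _) → 𝓐-torsion i)))

  #𝓜-contraction≡ : ∀ S → #𝓜-contraction Γ 𝓐 𝓐-torsion S G ≡
                           length (filter (λ φ → ≡-dec Bool._≟_ (zeroSets φ) S) (allFin N))
  #𝓜-contraction≡ S = #-unique em (𝓜-quotient-cardinality em (Γ tor) G Hom↔Fin 𝓐ₜ ((Γ tor) / span (Γ tor) (restrict 𝓐ₜ S)) S
    (projection-isQuotient (Γ tor) (restrict 𝓐ₜ S)))

  r≡0 : ∀ S → r Γ 𝓐 S ≡ 0
  r≡0 S = torsion-rank em (toGroup Γ (span Γ (restrict 𝓐 S))) λ (x , x∈⟨S⟩) → torsion-toGroup Γ (span Γ (restrict 𝓐 S))
    (Generated-least Γ (torsion Γ) (λ (i , _) → 𝓐-torsion i) x∈⟨S⟩) x∈⟨S⟩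

  coeff-tutte : ∀ i j → (coeff-x^ i y^ j) (tutte Γ 𝓐 G) ≡
                        Σℤ (allFin N) (λ φ → (coeff-x^ i y^ j) (𝕪 ^ ∣ zeroSets φ ∣))
  coeff-tutte i j = begin
    coeff (tutte Γ 𝓐 G)
      ≡⟨ coeff-∑ (subsets n) _ i j ⟩
    Σℤ (subsets n) (λ S → coeff (m Γ 𝓐 S G ·ₚ term S (r Γ 𝓐 ⊤) (r Γ 𝓐 S)))
      ≡⟨ Σℤ-cong (subsets n) (λ S → ≡.trans
           (coeff-·ₚ (m Γ 𝓐 S G) (term S (r Γ 𝓐 ⊤) (r Γ 𝓐 S)) i j)
           (≡.cong₂ (λ k P → + k ℤ.* coeff P) (m≡ S) (≡.cong₂ (term S) (r≡0 ⊤) (r≡0 S)))) ⟩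
    Σℤ (subsets n) (λ S → + length (filter (λ φ → S ⊆? zeroSets φ) (allFin N)) ℤ.* coeff (term S 0 0))
      ≡⟨ Σℤ-count (λ S φ → S ⊆? zeroSets φ) (subsets n) (allFin N) (λ S → coeff (term S 0 0)) ⟩
    Σℤ (allFin N) (λ φ → Σℤ (subsets n) (λ S → 𝟙 (S ⊆? zeroSets φ) ℤ.* coeff (term S 0 0)))
      ≡⟨ Σℤ-cong (allFin N) (λ φ → ≡.trans
           (Σℤ-cong (subsets n) (λ S →
             ≡.cong (𝟙 (S ⊆? zeroSets φ) ℤ.*_) (coeff-1#-* ((𝕪 + - 1#) ^ ∣ S ∣) i j)))
           (Σℤ-[𝕪-1]^ (zeroSets φ) i j)) ⟩
    Σℤ (allFin N) (λ φ → coeff (𝕪 ^ ∣ zeroSets φ ∣)) ∎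
    where
    coeff : Polynomial → ℤ
    coeff = coeff-x^ i y^ j

    term : Subset n → ℕ → ℕ → Polynomial
    term S r⊤ rS = (𝕩 + - 1#) ^ (r⊤ ∸ rS) * (𝕪 + - 1#) ^ (∣ S ∣ ∸ rS)

  contraction-polynomial : Polynomial
  contraction-polynomial = ∑ (upTo (suc n)) λ k →
    sum (map (λ S → #𝓜-contraction Γ 𝓐 𝓐-torsion S G) (subsetsOfSize n k)) ·ₚ (𝕪 ^ k)

  coeff-contraction-polynomial : ∀ i j → (coeff-x^ i y^ j) contraction-polynomial ≡
                                 Σℤ (allFin N) (λ φ → (coeff-x^ i y^ j) (𝕪 ^ ∣ zeroSets φ ∣))
  coeff-contraction-polynomial i j = begin
    coeff contraction-polynomial
      ≡⟨ coeff-∑ (upTo (suc n)) (λ k → sum (map w (subsetsOfSize n k)) ·ₚ (𝕪 ^ k)) i j ⟩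
    Σℤ (upTo (suc n)) (λ k → coeff (sum (map w (subsetsOfSize n k)) ·ₚ (𝕪 ^ k)))
      ≡⟨ Σℤ-cong (upTo (suc n)) (λ k → coeff-·ₚ (sum (map w (subsetsOfSize n k))) (𝕪 ^ k) i j) ⟩
    Σℤ (upTo (suc n)) (λ k → + sum (map w (subsetsOfSize n k)) ℤ.* coeff (𝕪 ^ k))
      -- `upTo (suc n)` ends at n, the largest possible size of a subset.
      ≡⟨ Σℤ-fibres ∣_∣ w (subsets n) (Unique.upTo⁺ (suc n))
           (λ S → ∈-upTo⁺ (ℕ.s≤s (∣p∣≤n S))) (λ k → coeff (𝕪 ^ k)) ⟩
    Σℤ (subsets n) (λ S → + w S ℤ.* coeff (𝕪 ^ ∣ S ∣))
      ≡⟨ Σℤ-cong (subsets n) (λ S → ≡.cong (λ k → + k ℤ.* coeff (𝕪 ^ ∣ S ∣)) (#𝓜-contraction≡ S)) ⟩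
    Σℤ (subsets n) (λ S →
      + length (filter (λ φ → ≡-dec Bool._≟_ (zeroSets φ) S) (allFin N)) ℤ.* coeff (𝕪 ^ ∣ S ∣))
      ≡⟨ Σℤ-count (λ S φ → ≡-dec Bool._≟_ (zeroSets φ) S) (subsets n) (allFin N) (λ S → coeff (𝕪 ^ ∣ S ∣)) ⟩
    Σℤ (allFin N) (λ φ → Σℤ (subsets n) (λ S → 𝟙 (≡-dec Bool._≟_ (zeroSets φ) S) ℤ.* coeff (𝕪 ^ ∣ S ∣)))
      ≡⟨ Σℤ-cong (allFin N) (λ φ → Σℤ-select (≡-dec Bool._≟_) (subsets-unique n)
           (∈-subsets (zeroSets φ)) (λ S → coeff (𝕪 ^ ∣ S ∣))) ⟩
    Σℤ (allFin N) (λ φ → coeff (𝕪 ^ ∣ zeroSets φ ∣)) ∎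
    where
    coeff : Polynomial → ℤ
    coeff = coeff-x^ i y^ j

    w : Subset n → ℕ
    w S = #𝓜-contraction Γ 𝓐 𝓐-torsion S G

mainTheorem8 :
    ∀ (em : ∀ a → ExcludedMiddle a) {c ℓ c′ ℓ′} →
    let open Classical em in
    (Γ : AbelianGroup c ℓ) → FinitelyGenerated Γ →
    (G : AbelianGroup c′ ℓ′) → TorsionWiseFinite G →
    ∀ {n : ℕ} (𝓐 : Vector (AbelianGroup.Carrier Γ) n) →
    (𝓐-torsion : ∀ i → IsTorsion Γ (𝓐 i)) →
    (tutte Γ 𝓐 G ≈
      ∑ (upTo (suc n)) (λ k →
        sum (map (λ S → #𝓜-contraction Γ 𝓐 𝓐-torsion S G) (subsetsOfSize n k)) ·ₚ (𝕪 ^ k)))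
    × (∀ i j → (coeff-x^ suc i y^ j) (tutte Γ 𝓐 G) ≡ + 0)
    × (∀ j → + 0 ℤ.≤ (coeff-x^ 0 y^ j) (tutte Γ 𝓐 G))
mainTheorem8 em Γ Γ-fg G G-finite 𝓐 𝓐-torsion =
    -- `≈` on ℤ[x,y] unfolds to equality of the coefficients of all monomials.
    (λ i j → ≡.trans (coeff≡ i j)
      (≡.sym (coeff-contraction-polynomial em Γ Γ-fg G G-finite 𝓐 𝓐-torsion i j)))
  , (λ i j → ≡.trans (coeff≡ (suc i) j) (Σℤ-zero (allFin _) (λ {φ} _ → coeff-x^suc-𝕪^ ∣ Z φ ∣ i j)))
  , (λ j → ≡.subst (+ 0 ℤ.≤_) (≡.sym (coeff≡ 0 j))
      (Σℤ-nonNegative (allFin _) (λ φ → coeff-𝕪^-nonNegative ∣ Z φ ∣ 0 j)))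
  where
  Z = zeroSets em Γ Γ-fg G G-finite 𝓐 𝓐-torsion
  coeff≡ = coeff-tutte em Γ Γ-fg G G-finite 𝓐 𝓐-torsion
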